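{- Let $U$ be a sunshine graph and $T$ a caterpillar of order $n\ge 12$ with $b(U,T)\ge 5$, and let $U^+$ be a sunshine supercard of $U$ and $T$ (with $w,v$, labelling and $\chi$ as in the context) chosen so that $\chi(U^+)$ is largest possible among all sunshine supercards of $U$ and $T$. Suppose that $B_U\ne\mathrm{Aut}(U^+)$. Then $b(U,T)\le 2\left\lfloor\sqrt{2n+1}\right\rfloor+3$.
   Context: All graphs are finite and simple. The deck of $G$ is the multiset of unlabelled cards $G-v$; $b(G,H)$ is the cardinality of the multiset intersection of the decks. The skeleton of a graph is obtained by deleting all vertices of degree $0$ or $1$; sunshine graph: connected, skeleton a cycle; caterpillar: connected, skeleton a path. A supercard of $U$ and $T$ is a graph of order $n+1$ whose deck contains cards isomorphic to $U$ and to $T$. For a sunshine supercard $U^+$, fix $w,v$ with $U^+-w\cong U$, $U^+-v\cong T$ ($w$ a leaf, $v$ a degree-2 cycle vertex); identify $U=U^+-w$, $T=U^+-v$. Label the cycle $x_0\ldots x_{c-1}x_0$ (indices mod $c$) with $x_0$ adjacent to $w$, $v=x_\nu$, $d_{U^+}(x_{\nu-1})\ge d_{U^+}(x_{\nu+1})$. Write $\lambda(G)=H$ if the bijection $\lambda$ is an isomorphism from $G$ onto $H$. $B_{vw}(U^+)=\{\lambda\in\mathrm{Sym}(V(U^+)):\lambda(U-\lambda^{ -1}(v))=T-\lambda(w)\}$, $B_U=\{\lambda\in B_{vw}(U^+):\lambda(U)=U^+-\lambda(w)\}$ (note $\mathrm{Aut}(U^+)\subseteq B_U$). A maximum saturating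 set is $X\subseteq B_{vw}(U^+)$ with: the identity in $X$; distinct $\lambda,\pi\in X$ have $\lambda^{ -1}(v)\ne\pi^{ -1}(v)$ and $\lambda(w)\ne\pi(w)$; and no $\sigma\in B_{vw}(U^+)\setminus X$ can be added keeping the previous property. $\chi(U^+)=\max|X\cap B_U|$ over maximum saturating sets $X$. -}

module Defs where

open import Data.Nat using (ℕ; zero; suc; _+_; _*_; _≤_; _<_)
open import Data.Bool using (Bool; true; false; if_then_else_)
open import Data.Fin using (Fin; toℕ; punchIn)
open import Data.Fin.Permutation using (Permutation′; _⟨$⟩ʳ_; _⟨$⟩ˡ_)
open import Data.List using (List; map; allFin)
open import Data.Nat.ListAction using (sum)
open import Data.Product using (Σ; ∃; _×_; _,_)
open import Data.Sum using (_⊎_)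
open import Relation.Binary.PropositionalEquality using (_≡_; _≢_)
open import Relation.Nullary using (¬_)
open import Function using (_⇔_)
open import Function.Definitions using (Injective)

record Graph (n : ℕ) : Set where
  field
    adj    : Fin n → Fin n → Bool
    sym    : ∀ i j → adj i j ≡ adj j i
    irrefl : ∀ i → adj i i ≡ false
open Graph public

deg : ∀ {n} → Graph n → Fin n → ℕ
deg {n} G v = sum (map (λ j → if adj G v j then 1 else 0) (allFin n))

data Reach {n} (G : Graph n) : Fin n → Fin n → Set where
  here : ∀ {x} → Reach G x x
  step : ∀ {x y z} → adj G x y ≡ true → Reach G y z → Reach G x z

Connected : ∀ {n} → Graph n → Set
Connected {n} G = ∀ (x y : Fin n) → Reach G x y

card : ∀ {m} → Graph (suc m) → Fin (suc m) → Graph m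
card G v = record
  { adj    = λ i j → adj G (punchIn v i) (punchIn v j)
  ; sym    = λ i j → sym G (punchIn v i) (punchIn v j)
  ; irrefl = λ i → irrefl G (punchIn v i) }

IsIsoBy : ∀ {n} → Permutation′ n → Graph n → Graph n → Set
IsIsoBy {n} π G H = ∀ (i j : Fin n) → adj H (π ⟨$⟩ʳ i) (π ⟨$⟩ʳ j) ≡ adj G i j

_≅_ : ∀ {n} → Graph n → Graph n → Set
G ≅ H = Σ (Permutation′ _) λ π → IsIsoBy π G H

-- b(G,H): cardinality of the multiset intersection of the decks.
-- A common sub-multiset of size k is a pair of injective choices of
-- k cards in each deck, matched up to isomorphism.

CommonCards : ∀ {m} → Graph (suc m) → Graph (suc m) → ℕ → Set
CommonCards {m} G H k =
  Σ (Fin k → Fin (suc m)) λ f → Σ (Fin k → Fin (suc m)) λ g →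
    Injective _≡_ _≡_ f × Injective _≡_ _≡_ g ×
    (∀ i → card G (f i) ≅ card H (g i))

IsB : ∀ {m} → Graph (suc m) → Graph (suc m) → ℕ → Set
IsB G H b = CommonCards G H b × (∀ k → CommonCards G H k → k ≤ b)

InSkel : ∀ {n} → Graph n → Fin n → Set
InSkel G x = 2 ≤ deg G x

SkeletonIsPath : ∀ {n} → Graph n → Set
SkeletonIsPath {n} G =
  Σ ℕ λ k → Σ (Fin k → Fin n) λ p →
    1 ≤ k × Injective _≡_ _≡_ p ×
    (∀ x → InSkel G x ⇔ ∃ λ i → p i ≡ x) ×
    (∀ i j → adj G (p i) (p j) ≡ true
               ⇔ (suc (toℕ i) ≡ toℕ j ⊎ suc (toℕ j) ≡ toℕ i))

CycSucc : ∀ {k} → Fin k → Fin k → Set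
CycSucc {k} i j = suc (toℕ i) ≡ toℕ j ⊎ (suc (toℕ i) ≡ k × toℕ j ≡ 0)

SkeletonIsCycle : ∀ {n} → Graph n → Set
SkeletonIsCycle {n} G =
  Σ ℕ λ k → Σ (Fin k → Fin n) λ p →
    3 ≤ k × Injective _≡_ _≡_ p ×
    (∀ x → InSkel G x ⇔ ∃ λ i → p i ≡ x) ×
    (∀ i j → adj G (p i) (p j) ≡ true ⇔ (CycSucc i j ⊎ CycSucc j i))

Sunshine : ∀ {n} → Graph n → Set
Sunshine G = Connected G × SkeletonIsCycle G

Caterpillar : ∀ {n} → Graph n → Set
Caterpillar G = Connected G × SkeletonIsPath G

record SunSuper {m} (U T : Graph (suc m)) : Set where
  field
    Up       : Graph (suc (suc m))
    w v      : Fin (suc (suc m))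
    sunshine : Sunshine Up
    cardW    : card Up w ≅ U
    cardV    : card Up v ≅ T
    wLeaf    : deg Up w ≡ 1
    vDeg2    : deg Up v ≡ 2
    vCycle   : InSkel Up v
open SunSuper public

module _ {m} {U T : Graph (suc m)} (C : SunSuper U T) where
  private
    N = suc (suc m)
    G = Up C

  Aut : Permutation′ N → Set
  Aut λ′ = IsIsoBy λ′ G G

  -- λ(U - λ⁻¹(v)) = T - λ(w), with U = U⁺ - w and T = U⁺ - v
  -- as induced subgraphs of U⁺
  Bvw : Permutation′ N → Set
  Bvw λ′ = ∀ x y → x ≢ w C → x ≢ (λ′ ⟨$⟩ˡ v C) → y ≢ w C → y ≢ (λ′ ⟨$⟩ˡ v C) →
             adj G (λ′ ⟨$⟩ʳ x) (λ′ ⟨$⟩ʳ y) ≡ adj G x y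

  BU : Permutation′ N → Set
  BU λ′ = Bvw λ′ × (∀ x y → x ≢ w C → y ≢ w C →
                     adj G (λ′ ⟨$⟩ʳ x) (λ′ ⟨$⟩ʳ y) ≡ adj G x y)

  -- a finite set X ⊆ Sym(V(U⁺)) presented as an indexed family (s , Λ)
  -- (distinctness of members is forced by the saturating property)
  record MaxSaturating : Set where
    field
      size     : ℕ
      Λ        : Fin size → Permutation′ N
      inB      : ∀ i → Bvw (Λ i)
      hasId    : ∃ λ i → ∀ x → Λ i ⟨$⟩ʳ x ≡ x
      separate : ∀ i j → i ≢ j →
                   (Λ i ⟨$⟩ˡ v C ≢ Λ j ⟨$⟩ˡ v C) × (Λ i ⟨$⟩ʳ w C ≢ Λ j ⟨$⟩ʳ w C)
      maximal  : ∀ σ → Bvw σ → (∀ i → ¬ (∀ x → σ ⟨$⟩ʳ x ≡ Λ i ⟨$⟩ʳ x)) →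
                   ∃ λ i → (Λ i ⟨$⟩ˡ v C ≡ σ ⟨$⟩ˡ v C) ⊎ (Λ i ⟨$⟩ʳ w C ≡ σ ⟨$⟩ʳ w C)

  ChiAtLeast : ℕ → Set
  ChiAtLeast k = Σ MaxSaturating λ X →
    Σ (Fin k → Fin (MaxSaturating.size X)) λ f →
      Injective _≡_ _≡_ f × (∀ i → BU (MaxSaturating.Λ X (f i)))

ChiMaximal : ∀ {m} {U T : Graph (suc m)} → SunSuper U T → Set
ChiMaximal {m} {U} {T} C = ∀ (C′ : SunSuper U T) k → ChiAtLeast C′ k → ChiAtLeast C k

IsFloorSqrt : ℕ → ℕ → Set
IsFloorSqrt N s = s * s ≤ N × N < suc s * suc s

{-# OPTIONS --safe #-}
-- Write U⁺ as a cyclic word d of vertex degrees along its cycle, o being the neighbour of w.  An element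
-- of B_U is a dihedral map α with d − e_o carried to d − e_j, and it lies in Aut(U⁺) exactly when α o = j.
-- If a non-automorphism (a "defect") exists, then commuting rotations and involutive reflections force
-- either j = o throughout, or at most four maps.  In the first case q separated elements need q leaves at
-- o, about q/2 further cycle vertices with q − 1 leaves each and q cycle vertices without leaves, which
-- gives (q + 1)² ≤ 2n + 1.
-- Conversely, a common card (x , y) with y away from the ends of the spine of T (at most four exceptions)
-- glues U and T along the card, and the two cycle neighbours of x sit at the two ends of the spine, each
-- on a spine end or on a leaf there.  The cycle length leaves only two possible gluings, and all common
-- cards of one gluing are separated elements of B_U for one supercard, so maximality of χ bounds their
-- number by s − 1.
module Submission where

open import Defs renaming (sym to adj-sym; irrefl to adj-irrefl)
open import Data.Nat
open import Data.Nat.Properties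
open import Algebra.Properties.Semiring.Sum +-*-semiring using (sum; sum-cong-≗; ∑-distrib-+; ∑-comm; sum-permute; sum-remove; *-distribˡ-sum)
open import Data.Bool using (Bool; true; false; if_then_else_; _∧_; _∨_; not)
open import Data.Bool.Properties using () renaming (_≟_ to _≟ᵇ_)
open import Data.Empty using (⊥; ⊥-elim)
open import Data.Fin using (Fin; zero; suc; toℕ; punchIn; punchOut; fromℕ; fromℕ<; inject₁; lower₁; opposite)
import Data.Fin.Properties as F
open import Data.Fin.Permutation using (Permutation′; transpose; lift₀; insert; remove; _∘ₚ_; _⟨$⟩ʳ_; _⟨$⟩ˡ_; inverseˡ; inverseʳ; insert-punchIn; punchIn-permute)
import Data.Fin.Permutation as Perm
open import Data.List using (tabulate)
open import Data.List.Properties using (map-tabulate)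
import Data.Nat.ListAction as L
open import Data.Nat.Solver using (module +-*-Solver)
open import Data.Product using (Σ; ∃; _×_; _,_; proj₁; proj₂)
open import Data.Sum using (_⊎_; inj₁; inj₂; [_,_]′)
open import Function using (_∘_; id; _⇔_; Equivalence; mk⇔)
open import Function.Definitions using (Injective)
open import Relation.Binary.PropositionalEquality hiding ([_])
open import Relation.Nullary using (¬_; Dec; yes; no; does; contradiction)
open import Relation.Nullary.Decidable using (dec-true; dec-false; ¬?; _⊎-dec_; decidable-stable)

-- The obstacle is that B_U is not closed under composition: two maps that each move one unit of `d`
-- may together move two. The argument lives on the products that stay under control: a symmetry
-- after any map, two maps with `j = o`, whose moved units telescope, and two rotations, compared in
-- both orders. Order matters for the constants: U⁺ has n + 1 vertices, and the counting yields (q +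
-- 1)² + 1 ≤ 2(n + 1). The hypothesis n ≥ 12 forces s ≥ 5, so the alternative of at most four maps
-- also gives q ≤ s - 1. A family of separated maps is enlarged to a maximum saturating set only up
-- to double negation, and the hypothesis B_U ≠ Aut(U⁺) supplies no explicit defect either. Both are
-- harmless, because the conclusions drawn are inequalities between natural numbers and hence
-- decidable.

private variable
  n k m : ℕ

-- Counting with indicator sums

ι : Bool → ℕ
ι b = if b then 1 else 0

ι≤1 : ∀ b → ι b ≤ 1
ι≤1 true  = ≤-refl
ι≤1 false = z≤n

ι-positive : ∀ {b} → 1 ≤ ι b → b ≡ true
ι-positive {true} _ = refl

true≢false : ∀ {b} → b ≡ true → b ≢ false
true≢false refl ()

≢true : ∀ {b} → b ≢ true → b ≡ false
≢true {true}  ne = contradiction refl ne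
≢true {false} ne = refl

bool-ext : ∀ {a b} → (a ≡ true → b ≡ true) → (b ≡ true → a ≡ true) → a ≡ b
bool-ext {true}  {b}     f g = sym (f refl)
bool-ext {false} {true}  f g = contradiction (g refl) λ ()
bool-ext {false} {false} f g = refl

infix 4 _==_

_==_ : Fin n → Fin n → Bool
i == j = does (i F.≟ j)

==-refl : ∀ (i : Fin n) → (i == i) ≡ true
==-refl i = dec-true (i F.≟ i) refl

==-true : ∀ {i j : Fin n} → i ≡ j → (i == j) ≡ true
==-true {i = i} refl = ==-refl i

==-false : ∀ {i j : Fin n} → i ≢ j → (i == j) ≡ false
==-false {i = i} {j} ne = dec-false (i F.≟ j) ne

==-sound : ∀ {i j : Fin n} → (i == j) ≡ true → i ≡ j
==-sound {i = i} {j} e with i F.≟ j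
... | yes p = p

==-iff : ∀ {i j : Fin n} {i′ j′ : Fin k} → (i ≡ j → i′ ≡ j′) → (i′ ≡ j′ → i ≡ j) →
         (i == j) ≡ (i′ == j′)
==-iff f g = bool-ext (==-true ∘ f ∘ ==-sound) (==-true ∘ g ∘ ==-sound)

sum-mono : {f g : Fin n → ℕ} → (∀ i → f i ≤ g i) → sum f ≤ sum g
sum-mono {zero}  h = z≤n
sum-mono {suc n} h = +-mono-≤ (h zero) (sum-mono (h ∘ suc))

sum-const : ∀ n c → sum {n} (λ _ → c) ≡ n * c
sum-const zero    c = refl
sum-const (suc n) c = cong (c +_) (sum-const n c)

term≤sum : ∀ (f : Fin n) (g : Fin n → ℕ) → g f ≤ sum g
term≤sum zero    g = m≤m+n _ _
term≤sum (suc i) g = ≤-trans (term≤sum i (g ∘ suc)) (m≤n+m _ _)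

sum-zero : {f : Fin n → ℕ} → (∀ i → f i ≡ 0) → sum f ≡ 0
sum-zero {zero}  h = refl
sum-zero {suc n} h = cong₂ _+_ (h zero) (sum-zero (h ∘ suc))

sum-positive : (P : Fin n → Bool) → 1 ≤ sum (ι ∘ P) → ∃ λ i → P i ≡ true
sum-positive {suc n} P h with P zero in eq
... | true  = zero , eq
... | false with sum-positive (P ∘ suc) h
...   | i , e = suc i , e

count≤1 : (P : Fin n → Bool) → (∀ i j → P i ≡ true → P j ≡ true → i ≡ j) → sum (ι ∘ P) ≤ 1
count≤1 {zero}  P h = z≤n
count≤1 {suc n} P h with P zero in eq
... | true  = ≤-reflexive (cong suc (sum-zero λ i → cong ι (≢true λ e → F.0≢1+n (h zero (suc i) eq e))))
... | false = count≤1 (P ∘ suc) λ i j e e′ → F.suc-injective (h _ _ e e′)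

sum-== : ∀ (a : Fin n) → sum (λ z → ι (z == a)) ≡ 1
sum-== a = ≤-antisym
  (count≤1 (_== a) λ i j e e′ → trans (==-sound e) (sym (==-sound e′)))
  (≤-trans (≤-reflexive (sym (cong ι (==-refl a)))) (term≤sum a (λ z → ι (z == a))))

two-of : (P : Fin n → Bool) → 2 ≤ sum (ι ∘ P) → ∀ a → ∃ λ b → P b ≡ true × b ≢ a
two-of P h a with sum-positive (λ z → P z ∧ does (¬? (z F.≟ a)) ) (≤-pred (≤-trans h (≤-trans (sum-mono le) (≤-reflexive split))))
  where
  Q : _ → Bool
  Q z = P z ∧ does (¬? (z F.≟ a))
  le : ∀ z → ι (P z) ≤ ι (z == a) + ι (Q z)
  le z with P z | z F.≟ a
  ... | true  | yes _ = s≤s z≤n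
  ... | true  | no  _ = s≤s z≤n
  ... | false | _ = z≤n
  split : sum (λ z → ι (z == a) + ι (Q z)) ≡ suc (sum (ι ∘ Q))
  split = trans (∑-distrib-+ (λ z → ι (z == a)) (ι ∘ Q)) (cong (_+ sum (ι ∘ Q)) (sum-== a))
... | b , e with P b in eq | b F.≟ a
...   | true | no ne = b , eq , ne

-- A sub-indicator stays below the indicator of P when a point of P outside its support is added;
-- iterating this bounds |P| from below.
add-point : (P : Fin n → Bool) (f : Fin n → ℕ) (a : Fin n) → (∀ z → f z ≤ ι (P z)) →
            f a ≡ 0 → P a ≡ true → ∀ z → f z + ι (z == a) ≤ ι (P z)
add-point P f a h fa Pa z with z F.≟ a
... | yes refl rewrite fa | Pa = ≤-refl
... | no  _ rewrite +-identityʳ (f z) = h z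

sum-add-point : (f : Fin n → ℕ) (a : Fin n) → sum (λ z → f z + ι (z == a)) ≡ sum f + 1
sum-add-point f a = trans (∑-distrib-+ f (λ z → ι (z == a))) (cong (sum f +_) (sum-== a))

count≥2 : (P : Fin n → Bool) {a b : Fin n} → P a ≡ true → P b ≡ true → a ≢ b → 2 ≤ sum (ι ∘ P)
count≥2 P {a} {b} Pa Pb a≢b = ≤-trans (≤-reflexive (sym eq))
  (sum-mono (add-point P _ b (add-point P (λ _ → 0) a (λ _ → z≤n) refl Pa) (cong ι (==-false (a≢b ∘ sym))) Pb))
  where
  eq = trans (sum-add-point (λ z → ι (z == a)) b) (cong (_+ 1) (sum-== a))

count≥3 : (P : Fin n → Bool) {a b c : Fin n} → P a ≡ true → P b ≡ true → P c ≡ true →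
          a ≢ b → a ≢ c → b ≢ c → 3 ≤ sum (ι ∘ P)
count≥3 P {a} {b} {c} Pa Pb Pc a≢b a≢c b≢c = ≤-trans (≤-reflexive (sym eq))
  (sum-mono (add-point P _ c
    (add-point P _ b (add-point P (λ _ → 0) a (λ _ → z≤n) refl Pa) (cong ι (==-false (a≢b ∘ sym))) Pb)
    (cong₂ (λ x y → ι x + ι y) (==-false (a≢c ∘ sym)) (==-false (b≢c ∘ sym))) Pc))
  where
  eq = trans (sum-add-point (λ z → ι (z == a) + ι (z == b)) c)
             (cong (_+ 1) (trans (sum-add-point (λ z → ι (z == a)) b) (cong (_+ 1) (sum-== a))))

-- Injectivity leaves at most one point in the fibre over `z`, and outside `P` there is none. Kept
-- pointwise, the bound can still be enlarged by `add-point` before it is summed.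
fibres≤ : (g : Fin k → Fin n) → Injective _≡_ _≡_ g → (P : Fin n → Bool) → (∀ t → P (g t) ≡ true) →
          ∀ z → sum (λ t → ι (z == g t)) ≤ ι (P z)
fibres≤ g inj P h z with P z in eq
... | true  = count≤1 (λ t → z == g t) λ i j e e′ → inj (trans (sym (==-sound {i = z} e)) (==-sound e′))
... | false = ≤-reflexive (sum-zero λ t → cong ι (==-false {i = z} {g t} λ e → true≢false (h t) (trans (cong P (sym e)) eq)))

sum-fibres : (g : Fin k → Fin n) → sum (λ z → sum (λ t → ι (z == g t))) ≡ k
sum-fibres {k} g = trans (∑-comm (λ z t → ι (z == g t)))
  (trans (sum-cong-≗ (λ t → sum-== (g t))) (trans (sum-const k 1) (*-identityʳ k)))

enumerate : (P : Fin n → Bool) → Σ (Fin (sum (ι ∘ P)) → Fin n) λ e →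
            Injective _≡_ _≡_ e × (∀ t → P (e t) ≡ true)
enumerate {zero}  P = (λ ()) , (λ { {()} }) , λ ()
enumerate {suc n} P with P zero in eq | enumerate (P ∘ suc)
... | false | e , inj , h = suc ∘ e , inj ∘ F.suc-injective , h
... | true  | e , inj , h = e′ , inj′ , h′
  where
  e′ : Fin (suc _) → Fin (suc n)
  e′ zero    = zero
  e′ (suc t) = suc (e t)
  inj′ : Injective _≡_ _≡_ e′
  inj′ {zero}  {zero}  _ = refl
  inj′ {zero}  {suc t} ()
  inj′ {suc s} {zero}  ()
  inj′ {suc s} {suc t} p = cong suc (inj (F.suc-injective p))
  h′ : ∀ t → P (e′ t) ≡ true
  h′ zero    = eq
  h′ (suc t) = h t

private
  list-sum : (f : Fin n → ℕ) → L.sum (tabulate f) ≡ sum f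
  list-sum {zero}  f = refl
  list-sum {suc n} f = cong (f zero +_) (list-sum (f ∘ suc))

deg-sum : ∀ (G : Graph n) v → deg G v ≡ sum (λ j → ι (adj G v j))
deg-sum G v = trans (cong L.sum (map-tabulate id (λ j → ι (adj G v j)))) (list-sum (λ j → ι (adj G v j)))

-- Degrees and isomorphisms off a vertex

infix 4 _∼[_]_

_∼[_]_ : Fin n → Graph n → Fin n → Set
x ∼[ G ] y = adj G x y ≡ true

∼-sym : ∀ (G : Graph n) {x y} → x ∼[ G ] y → y ∼[ G ] x
∼-sym G {x} {y} e = trans (adj-sym G y x) e

∼⇒≢ : ∀ (G : Graph n) {x y} → x ∼[ G ] y → x ≢ y
∼⇒≢ G {x} e refl = true≢false e (adj-irrefl G x)

perm-inj : ∀ (π : Permutation′ n) {i j} → π ⟨$⟩ʳ i ≡ π ⟨$⟩ʳ j → i ≡ j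
perm-inj π e = trans (sym (inverseˡ π)) (trans (cong (π ⟨$⟩ˡ_) e) (inverseˡ π))

neighbour-exists : ∀ (G : Graph n) {x} → 1 ≤ deg G x → ∃ λ y → x ∼[ G ] y
neighbour-exists G {x} h = sum-positive (adj G x) (subst (1 ≤_) (deg-sum G x) h)

other-neighbour : ∀ (G : Graph n) {x} → InSkel G x → ∀ a → ∃ λ b → x ∼[ G ] b × b ≢ a
other-neighbour G {x} h = two-of (adj G x) (subst (2 ≤_) (deg-sum G x) h)

neighbour⇒deg≥1 : ∀ (G : Graph n) {x y} → x ∼[ G ] y → 1 ≤ deg G x
neighbour⇒deg≥1 G {x} {y} e = subst (1 ≤_) (sym (deg-sum G x))
  (≤-trans (≤-reflexive (cong ι (sym e))) (term≤sum y (ι ∘ adj G x)))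

two-neighbours : ∀ (G : Graph n) {x a b} → x ∼[ G ] a → x ∼[ G ] b → a ≢ b → InSkel G x
two-neighbours G {x} ea eb ne = subst (2 ≤_) (sym (deg-sum G x)) (count≥2 (adj G x) ea eb ne)

three-neighbours : ∀ (G : Graph n) {x a b c} → x ∼[ G ] a → x ∼[ G ] b → x ∼[ G ] c →
                   a ≢ b → a ≢ c → b ≢ c → 3 ≤ deg G x
three-neighbours G {x} ea eb ec n₁ n₂ n₃ =
  subst (3 ≤_) (sym (deg-sum G x)) (count≥3 (adj G x) ea eb ec n₁ n₂ n₃)

skel? : ∀ (G : Graph n) x → Dec (InSkel G x)
skel? G x = 2 ≤? deg G x

¬skel⇒deg≤1 : ∀ (G : Graph n) {x} → ¬ InSkel G x → deg G x ≤ 1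
¬skel⇒deg≤1 G h = ≤-pred (≰⇒> h)

leaf-unique : ∀ (G : Graph n) {x a b} → ¬ InSkel G x → x ∼[ G ] a → x ∼[ G ] b → a ≡ b
leaf-unique G {x} {a} {b} h ea eb with a F.≟ b
... | yes e = e
... | no ne = contradiction (two-neighbours G ea eb ne) h

neighbours-of-deg2 : ∀ (G : Graph n) {x a b c} → deg G x ≤ 2 → x ∼[ G ] a → x ∼[ G ] b → a ≢ b →
                     x ∼[ G ] c → c ≡ a ⊎ c ≡ b
neighbours-of-deg2 G {x} {a} {b} {c} h ea eb ne ec with c F.≟ a | c F.≟ b
... | yes e | _     = inj₁ e
... | no  _ | yes e = inj₂ e
... | no n₁ | no n₂ = contradiction (three-neighbours G ea eb ec ne (n₁ ∘ sym) (n₂ ∘ sym)) (<⇒≱ (s≤s h))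

-- Two adjacent vertices outside the skeleton form a whole component: a walk from `x` never leaves
-- the pair, so it cannot reach the skeleton vertex `r`.
leaf-neighbour-skel : ∀ (G : Graph n) → Connected G → ∀ {r} → InSkel G r →
                      ∀ {x z} → x ∼[ G ] z → ¬ InSkel G x → InSkel G z
leaf-neighbour-skel G conn {r} hr {x} {z} e hx with skel? G z
... | yes h = h
... | no hz = ⊥-elim ([ (λ { refl → hx hr }) , (λ { refl → hz hr }) ]′ (end (inj₁ refl) (conn x r)))
  where
  end : ∀ {a b} → a ≡ x ⊎ a ≡ z → Reach G a b → b ≡ x ⊎ b ≡ z
  end h here = h
  end (inj₁ refl) (step e′ rest) = end (inj₂ (leaf-unique G hx e′ e)) rest
  end (inj₂ refl) (step e′ rest) = end (inj₁ (leaf-unique G hz e′ (∼-sym G e))) rest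

connected⇒deg≥1 : ∀ (G : Graph n) → Connected G → ∀ {x y} → x ≢ y → 1 ≤ deg G x
connected⇒deg≥1 G conn {x} {y} ne with conn x y
... | here       = contradiction refl ne
... | step e _ = neighbour⇒deg≥1 G e

-- The exchange form of `sum f - f x = sum g - g x`, free of truncated subtraction.
sum-except : (f g : Fin n → ℕ) (x : Fin n) → (∀ z → z ≢ x → f z ≡ g z) → sum f + g x ≡ sum g + f x
sum-except f g zero h rewrite sum-cong-≗ {x = f ∘ suc} {g ∘ suc} (λ i → h (suc i) λ ()) =
  solve 3 (λ a b c → a :+ b :+ c := c :+ b :+ a) refl (f zero) (sum (g ∘ suc)) (g zero)
  where open +-*-Solver
sum-except f g (suc x) h rewrite h zero (λ ()) =
  trans (+-assoc (g zero) _ _) (trans (cong (g zero +_) (sum-except (f ∘ suc) (g ∘ suc) x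
    λ z ne → h (suc z) (ne ∘ F.suc-injective))) (sym (+-assoc (g zero) _ _)))

-- An isomorphism from `G - x` onto `H - π x`, extended to a permutation by `x ↦ π x`. Common cards
-- of U and T and elements of B_U both have this form, so one degree formula serves both.
IsoOff : Fin n → Permutation′ n → Graph n → Graph n → Set
IsoOff x π G H = ∀ a b → a ≢ x → b ≢ x → adj H (π ⟨$⟩ʳ a) (π ⟨$⟩ʳ b) ≡ adj G a b

deg-permute : ∀ (H : Graph n) (π : Permutation′ n) a → deg H a ≡ sum (λ z → ι (adj H a (π ⟨$⟩ʳ z)))
deg-permute H π a = trans (deg-sum H a) (sum-permute (λ z → ι (adj H a z)) π)

-- The neighbourhoods of `a` and of its image correspond except at `x` and `π x`. On a cycle this
-- equation becomes the field `shift`.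
deg-isoOff : ∀ (G H : Graph n) {x} (π : Permutation′ n) → IsoOff x π G H → ∀ a → a ≢ x →
             deg H (π ⟨$⟩ʳ a) + ι (adj G a x) ≡ deg G a + ι (adj H (π ⟨$⟩ʳ a) (π ⟨$⟩ʳ x))
deg-isoOff G H {x} π h a a≢x = trans (cong (_+ ι (adj G a x)) (deg-permute H π (π ⟨$⟩ʳ a)))
  (trans (sum-except (λ z → ι (adj H (π ⟨$⟩ʳ a) (π ⟨$⟩ʳ z))) (λ z → ι (adj G a z)) x
            (λ z z≢x → cong ι (h a z a≢x z≢x)))
         (cong (_+ _) (sym (deg-sum G a))))

degreeSum : Graph n → ℕ
degreeSum G = sum (deg G)

deg-col : ∀ (G : Graph n) x → sum (λ a → ι (adj G a x)) ≡ deg G x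
deg-col G x = trans (sum-cong-≗ λ a → cong ι (adj-sym G a x)) (sym (deg-sum G x))

-- Both graphs have equally many edges left once `x` and `π x` are deleted. Its use is to find the
-- degree of one deleted vertex from that of the other.
degreeSum-isoOff : ∀ (G H : Graph n) {x} (π : Permutation′ n) → IsoOff x π G H →
                   degreeSum H + 2 * deg G x ≡ degreeSum G + 2 * deg H (π ⟨$⟩ʳ x)
degreeSum-isoOff G H {x} π h = begin
  degreeSum H + 2 * deg G x                          ≡⟨ solve 2 (λ a b → a :+ con 2 :* b := (a :+ b) :+ (b :+ con 0)) refl (degreeSum H) (deg G x) ⟩
  (degreeSum H + deg G x) + (deg G x + 0)            ≡⟨ cong₂ _+_ (sym sf) (cong (λ t → deg G x + ι t) (sym (adj-irrefl H (π ⟨$⟩ʳ x)))) ⟩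
  sum f + g x                                        ≡⟨ sum-except f g x (λ a a≢x → deg-isoOff G H π h a a≢x) ⟩
  sum g + f x                                        ≡⟨ cong₂ _+_ sg (cong (λ t → deg H (π ⟨$⟩ʳ x) + ι t) (adj-irrefl G x)) ⟩
  (degreeSum G + deg H (π ⟨$⟩ʳ x)) + (deg H (π ⟨$⟩ʳ x) + 0) ≡⟨ solve 2 (λ a b → (a :+ b) :+ (b :+ con 0) := a :+ con 2 :* b) refl (degreeSum G) (deg H (π ⟨$⟩ʳ x)) ⟩
  degreeSum G + 2 * deg H (π ⟨$⟩ʳ x) ∎
  where
  open ≡-Reasoning
  open +-*-Solver
  f g : Fin _ → ℕ
  f a = deg H (π ⟨$⟩ʳ a) + ι (adj G a x)
  g a = deg G a + ι (adj H (π ⟨$⟩ʳ a) (π ⟨$⟩ʳ x))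
  sf : sum f ≡ degreeSum H + deg G x
  sf = trans (∑-distrib-+ (λ a → deg H (π ⟨$⟩ʳ a)) (λ a → ι (adj G a x)))
             (cong₂ _+_ (sym (sum-permute (deg H) π)) (deg-col G x))
  sg : sum g ≡ degreeSum G + deg H (π ⟨$⟩ʳ x)
  sg = trans (∑-distrib-+ (deg G) (λ a → ι (adj H (π ⟨$⟩ʳ a) (π ⟨$⟩ʳ x))))
             (cong (degreeSum G +_) (trans (sym (sum-permute (λ a → ι (adj H a (π ⟨$⟩ʳ x))) π)) (deg-col H (π ⟨$⟩ʳ x))))

degreeSum-card : ∀ (G : Graph (suc n)) v → degreeSum G ≡ 2 * deg G v + degreeSum (card G v)
degreeSum-card G v = begin
  sum (deg G)                                         ≡⟨ sum-remove {i = v} (deg G) ⟩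
  deg G v + sum (λ i → deg G (punchIn v i))           ≡⟨ cong (deg G v +_) (sum-cong-≗ split) ⟩
  deg G v + sum (λ i → ι (adj G (punchIn v i) v) + deg (card G v) i)
                                                      ≡⟨ cong (deg G v +_) (∑-distrib-+ (λ i → ι (adj G (punchIn v i) v)) (deg (card G v))) ⟩
  deg G v + (sum (λ i → ι (adj G (punchIn v i) v)) + degreeSum (card G v))
                                                      ≡⟨ cong (λ t → deg G v + (t + degreeSum (card G v))) (sym col) ⟩
  deg G v + (deg G v + degreeSum (card G v))          ≡⟨ solve 2 (λ a b → a :+ (a :+ b) := con 2 :* a :+ b) refl (deg G v) (degreeSum (card G v)) ⟩
  2 * deg G v + degreeSum (card G v)                  ∎
  where
  open ≡-Reasoning
  open +-*-Solver
  split : ∀ i → deg G (punchIn v i) ≡ ι (adj G (punchIn v i) v) + deg (card G v) i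
  split i = trans (deg-sum G (punchIn v i)) (trans (sum-remove {i = v} (λ j → ι (adj G (punchIn v i) j)))
              (cong (ι (adj G (punchIn v i) v) +_) (sym (deg-sum (card G v) i))))
  col : deg G v ≡ sum (λ i → ι (adj G (punchIn v i) v))
  col = trans (sym (deg-col G v)) (trans (sum-remove {i = v} (λ a → ι (adj G a v)))
          (cong (λ t → ι t + sum (λ i → ι (adj G (punchIn v i) v))) (adj-irrefl G v)))

degreeSum-≅ : ∀ {G H : Graph n} → G ≅ H → degreeSum G ≡ degreeSum H
degreeSum-≅ {G = G} {H} (π , h) = trans
  (sum-cong-≗ λ a → trans (deg-sum G a) (trans (sum-cong-≗ λ b → cong ι (sym (h a b))) (sym (deg-permute H π (π ⟨$⟩ʳ a)))))
  (sym (sum-permute (deg H) π))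

card-≅⇒isoOff : ∀ {G H : Graph (suc n)} {x y} → card G x ≅ card H y →
                Σ (Permutation′ (suc n)) λ π → π ⟨$⟩ʳ x ≡ y × IsoOff x π G H
card-≅⇒isoOff {G = G} {H} {x} {y} (π , h) = π⁺ , at-x , off
  where
  π⁺ = insert x y π
  at-x : π⁺ ⟨$⟩ʳ x ≡ y
  at-x with x F.≟ x
  ... | yes _ = refl
  ... | no ne = contradiction refl ne
  off : IsoOff x π⁺ G H
  off a b a≢x b≢x
    rewrite sym (F.punchIn-punchOut (a≢x ∘ sym)) | sym (F.punchIn-punchOut (b≢x ∘ sym))
          | insert-punchIn x y π (punchOut (a≢x ∘ sym)) | insert-punchIn x y π (punchOut (b≢x ∘ sym)) = h _ _

iso⇒card-≅ : ∀ {G H : Graph (suc n)} (π : Permutation′ (suc n)) → IsIsoBy π G H →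
             ∀ {x y} → π ⟨$⟩ʳ x ≡ y → card G x ≅ card H y
iso⇒card-≅ {G = G} {H} π h {x} refl = remove x π , λ i j →
  trans (sym (cong₂ (adj H) (punchIn-permute π x i) (punchIn-permute π x j))) (h _ _)

-- The dihedral group of a cycle

module Cyclic {c′ : ℕ} where

  private
    c = suc c′
    K = Fin c

  CycSucc-functional : ∀ {i j j′ : K} → CycSucc i j → CycSucc i j′ → j ≡ j′
  CycSucc-functional {j = j} {j′} (inj₁ p) (inj₁ q) = F.toℕ-injective (trans (sym p) q)
  CycSucc-functional {j = j} {j′} (inj₁ p) (inj₂ (q , _)) = contradiction (trans (sym p) q) (<⇒≢ (F.toℕ<n j))
  CycSucc-functional {j = j} {j′} (inj₂ (p , _)) (inj₁ q) = contradiction (trans (sym q) p) (<⇒≢ (F.toℕ<n j′))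
  CycSucc-functional (inj₂ (_ , p)) (inj₂ (_ , q)) = F.toℕ-injective (trans p (sym q))

  CycSucc-injective : ∀ {i i′ j : K} → CycSucc i j → CycSucc i′ j → i ≡ i′
  CycSucc-injective (inj₁ p) (inj₁ q) = F.toℕ-injective (suc-injective (trans p (sym q)))
  CycSucc-injective (inj₁ p) (inj₂ (_ , q)) = contradiction (trans p q) λ ()
  CycSucc-injective (inj₂ (_ , p)) (inj₁ q) = contradiction (trans q p) λ ()
  CycSucc-injective (inj₂ (p , _)) (inj₂ (q , _)) = F.toℕ-injective (suc-injective (trans p (sym q)))

  abstract
    next : K → K
    next i with c′ ≟ toℕ i
    ... | yes _ = zero
    ... | no ne = suc (lower₁ i ne)

    CycSucc-next : ∀ i → CycSucc i (next i)
    CycSucc-next i with c′ ≟ toℕ i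
    ... | yes e = inj₂ (cong suc (sym e) , refl)
    ... | no ne = inj₁ (cong suc (sym (F.toℕ-lower₁ i ne)))

  prev : K → K
  prev zero    = fromℕ c′
  prev (suc i) = inject₁ i

  CycSucc-prev : ∀ i → CycSucc (prev i) i
  CycSucc-prev zero    = inj₂ (cong suc (F.toℕ-fromℕ c′) , refl)
  CycSucc-prev (suc i) = inj₁ (cong suc (F.toℕ-inject₁ i))

  next-prev : ∀ i → next (prev i) ≡ i
  next-prev i = CycSucc-functional (CycSucc-next (prev i)) (CycSucc-prev i)

  prev-next : ∀ i → prev (next i) ≡ i
  prev-next i = CycSucc-injective (CycSucc-prev (next i)) (CycSucc-next i)

  next-injective : ∀ {i j} → next i ≡ next j → i ≡ j
  next-injective {i} {j} e = trans (sym (prev-next i)) (trans (cong prev e) (prev-next j))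

  next^ : ℕ → K → K
  next^ zero    i = i
  next^ (suc r) i = next (next^ r i)

  next^-injective : ∀ r {i j} → next^ r i ≡ next^ r j → i ≡ j
  next^-injective zero    e = e
  next^-injective (suc r) e = next^-injective r (next-injective e)

  next^-comm : ∀ r i → next^ r (next i) ≡ next (next^ r i)
  next^-comm zero    i = refl
  next^-comm (suc r) i = cong next (next^-comm r i)

  next^-+ : ∀ r s i → next^ (r + s) i ≡ next^ r (next^ s i)
  next^-+ zero    s i = refl
  next^-+ (suc r) s i = cong next (next^-+ r s i)

  toℕ-next^-zero : ∀ r → r < c → toℕ (next^ r zero) ≡ r
  toℕ-next^-zero zero    _ = refl
  toℕ-next^-zero (suc r) h with CycSucc-next (next^ r zero) | toℕ-next^-zero r (<-trans (n<1+n r) h)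
  ... | inj₁ p       | ih = trans (sym p) (cong suc ih)
  ... | inj₂ (p , _) | ih = contradiction (trans (cong suc (sym ih)) p) (<⇒≢ h)

  next^-toℕ : ∀ i → next^ (toℕ i) zero ≡ i
  next^-toℕ i = F.toℕ-injective (toℕ-next^-zero (toℕ i) (F.toℕ<n i))

  next^-c-zero : next^ c zero ≡ zero
  next^-c-zero with CycSucc-next (next^ c′ zero)
  ... | inj₁ p       = contradiction (trans (sym p) (cong suc (toℕ-next^-zero c′ ≤-refl))) (<⇒≢ (F.toℕ<n (next (next^ c′ zero))))
  ... | inj₂ (_ , p) = F.toℕ-injective p

  -- From `a`, going on for `c ∸ toℕ a` steps reaches `zero`, and `toℕ i` further steps reach `i`;
  -- the base point is therefore arbitrary.
  cyclic-induction : (P : K → Set) → (∀ i → P i → P (next i)) → ∀ a → P a → ∀ i → P i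
  cyclic-induction P keep a Pa i = subst P (next^-toℕ i) (steps (toℕ i) (subst P around (steps (c ∸ toℕ a) Pa)))
    where
    steps : ∀ r {x} → P x → P (next^ r x)
    steps zero    h = h
    steps (suc r) h = keep _ (steps r h)
    around : next^ (c ∸ toℕ a) a ≡ zero
    around = begin
      next^ (c ∸ toℕ a) a                     ≡⟨ cong (next^ (c ∸ toℕ a)) (sym (next^-toℕ a)) ⟩
      next^ (c ∸ toℕ a) (next^ (toℕ a) zero)  ≡⟨ sym (next^-+ (c ∸ toℕ a) (toℕ a) zero) ⟩
      next^ (c ∸ toℕ a + toℕ a) zero          ≡⟨ cong (λ r → next^ r zero) (m∸n+n≡m (<⇒≤ (F.toℕ<n a))) ⟩
      next^ c zero                            ≡⟨ next^-c-zero ⟩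
      zero                                    ∎
      where open ≡-Reasoning

  next^-c : ∀ i → next^ c i ≡ i
  next^-c = cyclic-induction (λ i → next^ c i ≡ i) (λ i e → trans (next^-comm c i) (cong next e)) zero next^-c-zero

  module _ (3≤c : 3 ≤ c) where

    next²≢ : ∀ i → next (next i) ≢ i
    next²≢ i e with CycSucc-next i | subst (CycSucc (next i)) e (CycSucc-next (next i))
    ... | inj₁ p | inj₁ q = contradiction (trans (cong suc p) q) (≢-sym (m≢1+n+m _ {1}))
    ... | inj₁ p | inj₂ (q , z) = contradiction (subst (3 ≤_) (trans (sym q) (cong suc (trans (sym p) (cong suc z)))) 3≤c) λ { (s≤s (s≤s ())) }
    ... | inj₂ (p , z) | inj₁ q = contradiction (subst (3 ≤_) (trans (sym p) (cong suc (trans (sym q) (cong suc z)))) 3≤c) λ { (s≤s (s≤s ())) }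
    ... | inj₂ (p , z) | inj₂ (q , z′) = contradiction (subst (3 ≤_) (trans (sym q) (cong suc z)) 3≤c) λ { (s≤s ()) }

    next≢prev : ∀ i → next i ≢ prev i
    next≢prev i e = next²≢ (prev i) (trans (cong next (next-prev i)) e)

  Rotation Reflection : (K → K) → Set
  Rotation   ρ = ∀ i → ρ (next i) ≡ next (ρ i)
  Reflection σ = ∀ i → σ (next i) ≡ prev (σ i)

  -- The direction chosen at `zero` persists: a reversal would give `α (next (next i))` the value
  -- `α i`, against injectivity on a cycle of length at least 3.
  dihedral : 3 ≤ c → ∀ {α} → Injective _≡_ _≡_ α →
             (∀ i → α (next i) ≡ next (α i) ⊎ α (next i) ≡ prev (α i)) →
             Rotation α ⊎ Reflection α
  dihedral 3≤c {α} inj adjacent with adjacent zero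
  ... | inj₁ e = inj₁ (cyclic-induction _ keep zero e)
    where
    keep : ∀ i → α (next i) ≡ next (α i) → α (next (next i)) ≡ next (α (next i))
    keep i h with adjacent (next i)
    ... | inj₁ e = e
    ... | inj₂ e = contradiction (inj (trans e (trans (cong prev h) (prev-next (α i))))) (next²≢ 3≤c i)
  ... | inj₂ e = inj₂ (cyclic-induction _ keep zero e)
    where
    keep : ∀ i → α (next i) ≡ prev (α i) → α (next (next i)) ≡ prev (α (next i))
    keep i h with adjacent (next i)
    ... | inj₂ e = e
    ... | inj₁ e = contradiction (inj (trans e (trans (cong next h) (next-prev (α i))))) (next²≢ 3≤c i)

  rotation-prev : ∀ {ρ} → Rotation ρ → ∀ i → ρ (prev i) ≡ prev (ρ i)
  rotation-prev {ρ} r i = trans (sym (prev-next _)) (cong prev (trans (sym (r (prev i))) (cong ρ (next-prev i))))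

  reflection-prev : ∀ {σ} → Reflection σ → ∀ i → σ (prev i) ≡ next (σ i)
  reflection-prev {σ} s i = trans (sym (next-prev _)) (cong next (trans (sym (s (prev i))) (cong σ (next-prev i))))

  rotation-ext : ∀ {ρ ρ′} → Rotation ρ → Rotation ρ′ → ∀ a → ρ a ≡ ρ′ a → ∀ i → ρ i ≡ ρ′ i
  rotation-ext r r′ = cyclic-induction _ λ i e → trans (r i) (trans (cong next e) (sym (r′ i)))

  reflection-ext : ∀ {σ σ′} → Reflection σ → Reflection σ′ → ∀ a → σ a ≡ σ′ a → ∀ i → σ i ≡ σ′ i
  reflection-ext s s′ = cyclic-induction _ λ i e → trans (s i) (trans (cong prev e) (sym (s′ i)))

  rotation∘rotation : ∀ {ρ ρ′} → Rotation ρ → Rotation ρ′ → Rotation (ρ ∘ ρ′)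
  rotation∘rotation {ρ} r r′ i = trans (cong ρ (r′ i)) (r _)

  rotation∘reflection : ∀ {ρ σ} → Rotation ρ → Reflection σ → Reflection (ρ ∘ σ)
  rotation∘reflection {ρ} r s i = trans (cong ρ (s i)) (rotation-prev r _)

  reflection∘rotation : ∀ {ρ σ} → Reflection σ → Rotation ρ → Reflection (σ ∘ ρ)
  reflection∘rotation {σ = σ} s r i = trans (cong σ (r i)) (s _)

  reflection∘reflection : ∀ {σ τ} → Reflection σ → Reflection τ → Rotation (σ ∘ τ)
  reflection∘reflection {σ} s t i = trans (cong σ (t i)) (reflection-prev {σ} s _)

  rotation-next^ : ∀ {ρ} → Rotation ρ → ∀ r i → ρ (next^ r i) ≡ next^ r (ρ i)
  rotation-next^ h zero    i = refl
  rotation-next^ h (suc r) i = trans (h _) (cong next (rotation-next^ h r i))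

  as-next^ : ∀ a i → ∃ λ r → next^ r a ≡ i
  as-next^ a = cyclic-induction _ (λ { i (r , e) → suc r , cong next e }) a (0 , refl)

  rotations-commute : ∀ {ρ ρ′} → Rotation ρ → Rotation ρ′ → ∀ i → ρ (ρ′ i) ≡ ρ′ (ρ i)
  rotations-commute {ρ} {ρ′} r r′ with as-next^ zero (ρ zero)
  ... | k , e = λ i → trans (powers (ρ′ i)) (trans (sym (rotation-next^ r′ k i)) (cong ρ′ (sym (powers i))))
    where
    powers : ∀ i → ρ i ≡ next^ k i
    powers = rotation-ext r (next^-comm k) zero (sym e)

  -- The square is a rotation, so it suffices to fix `zero`. With `σ zero = next^ k zero`, moving
  -- `k` steps through `σ` reverses them, and cancelling `next^ k` gives the claim.
  reflection-involutive : ∀ {σ} → Reflection σ → ∀ i → σ (σ i) ≡ i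
  reflection-involutive {σ} s = rotation-ext (reflection∘reflection {σ} {σ} s s) (λ _ → refl) zero at-zero
    where
    unwind : ∀ r i → next^ r (σ (next^ r i)) ≡ σ i
    unwind zero    i = refl
    unwind (suc r) i = trans (sym (next^-comm r _))
      (trans (cong (next^ r) (trans (cong next (s _)) (next-prev _))) (unwind r i))
    at-zero : σ (σ zero) ≡ zero
    at-zero with as-next^ zero (σ zero)
    ... | k , e = next^-injective k (trans (cong (next^ k ∘ σ) (sym e)) (trans (unwind k zero) (sym e)))

  rotation-surjective : ∀ {ρ} → Rotation ρ → ∀ j → ∃ λ i → ρ i ≡ j
  rotation-surjective {ρ} r = cyclic-induction _ (λ { j (i , e) → next i , trans (r i) (cong next e) }) (ρ zero) (zero , refl)

  dihedral-surjective : ∀ {α} → Rotation α ⊎ Reflection α → ∀ j → ∃ λ i → α i ≡ j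
  dihedral-surjective     (inj₁ r) = rotation-surjective r
  dihedral-surjective {σ} (inj₂ s) j = σ j , reflection-involutive {σ} s j

-- Words carried to themselves up to a moved unit

module CyclicWord {c′ : ℕ} (d : Fin (suc c′) → ℕ) (o : Fin (suc c′)) where

  open Cyclic {c′}

  -- The field `shift` is the equation `d i - [i = o] = d (α i) - [α i = j]` with the negative terms
  -- moved across.
  record Shift : Set where
    field
      α        : Fin (suc c′) → Fin (suc c′)
      j        : Fin (suc c′)
      inj      : Injective _≡_ _≡_ α
      dihedral-α : Rotation α ⊎ Reflection α
      shift    : ∀ i → d i + ι (α i == j) ≡ d (α i) + ι (i == o)

  open Shift

  Rot Refl Symmetry Defect : Shift → Set
  Rot t      = Rotation (α t)
  Refl t     = Reflection (α t)
  Symmetry t = α t o ≡ j t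
  Defect t   = α t o ≢ j t

  symmetry? : ∀ t → Symmetry t ⊎ Defect t
  symmetry? t with α t o F.≟ j t
  ... | yes e = inj₁ e
  ... | no ne = inj₂ ne

  involutive : ∀ t → Refl t → ∀ i → α t (α t i) ≡ i
  involutive t = reflection-involutive {α t}

  rot-ext : ∀ {s t} → Rot s → Rot t → ∀ a → α s a ≡ α t a → ∀ i → α s i ≡ α t i
  rot-ext {s} {t} = rotation-ext {α s} {α t}

  -- At the preimage of `j s` the two instances of `shift` differ only in the indicator of `j`,
  -- which must then be 1 for `t` as well.
  j-determined : ∀ s t → (∀ i → α s i ≡ α t i) → j s ≡ j t
  j-determined s t e with dihedral-surjective {α s} (dihedral-α s) (j s)
  ... | i , p = trans (sym p) (trans (e i) (==-sound (ι-injective (+-cancelˡ-≡ (d i) _ _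
      (trans (shift t i) (trans (cong (λ k → d k + ι (i == o)) (sym (e i))) (trans (sym (shift s i)) (cong (λ b → d i + ι b) (==-true p)))))))))
    where
    ι-injective : ∀ {b} → ι b ≡ 1 → b ≡ true
    ι-injective {true} _ = refl

  symmetry-invariant : ∀ g → Symmetry g → ∀ k → d k ≡ d (α g k)
  symmetry-invariant g e k = +-cancelʳ-≡ _ _ _
    (trans (cong (λ b → d k + ι b) (==-iff {i = k} {o} {α g k} {j g} (λ p → trans (cong (α g) p) e) (λ p → inj g (trans p (sym e)))))
           (shift g k))

  compose-dihedral : ∀ g t → Rotation (α g ∘ α t) ⊎ Reflection (α g ∘ α t)
  compose-dihedral g t with dihedral-α g | dihedral-α t
  ... | inj₁ r | inj₁ r′ = inj₁ (rotation∘rotation {α g} {α t} r r′)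
  ... | inj₁ r | inj₂ s′ = inj₂ (rotation∘reflection {α g} {α t} r s′)
  ... | inj₂ s | inj₁ r′ = inj₂ (reflection∘rotation {α t} {α g} s r′)
  ... | inj₂ s | inj₂ s′ = inj₁ (reflection∘reflection {α g} {α t} s s′)

  -- A symmetry leaves `d` invariant, so it only relabels the target of `t`, and the moved unit
  -- arrives at `α g (j t)`.
  _after_ : ∀ {g} → Symmetry g → Shift → Shift
  _after_ {g} e t = record
    { α = α g ∘ α t
    ; j = α g (j t)
    ; inj = inj t ∘ inj g
    ; dihedral-α = compose-dihedral g t
    ; shift = λ i → trans (cong (λ b → d i + ι b) (==-iff {i = α g (α t i)} {α g (j t)} {α t i} {j t} (inj g) (cong (α g))))
                      (trans (shift t i) (cong (_+ ι (i == o)) (symmetry-invariant g e (α t i))))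
    }

  -- The unit that `t` puts at `o` is the one that `s` takes from there; the two indicators of
  -- `α t i = o` cancel and one moved unit is left.
  compose-at-o : ∀ s t → j s ≡ o → j t ≡ o → Shift
  compose-at-o s t js jt = record
    { α = α s ∘ α t
    ; j = o
    ; inj = inj t ∘ inj s
    ; dihedral-α = compose-dihedral s t
    ; shift = λ i → +-cancelʳ-≡ (ι (α t i == o)) _ _ (begin
        d i + ι (α s (α t i) == o) + ι (α t i == o)   ≡⟨ xyz (d i) _ _ ⟩
        d i + ι (α t i == o) + ι (α s (α t i) == o)   ≡⟨ cong (_+ ι (α s (α t i) == o)) (subst (λ x → d i + ι (α t i == x) ≡ _) jt (shift t i)) ⟩
        d (α t i) + ι (i == o) + ι (α s (α t i) == o) ≡⟨ xyz (d (α t i)) _ _ ⟩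
        d (α t i) + ι (α s (α t i) == o) + ι (i == o) ≡⟨ cong (_+ ι (i == o)) (subst (λ x → d (α t i) + ι (α s (α t i) == x) ≡ _) js (shift s (α t i))) ⟩
        d (α s (α t i)) + ι (α t i == o) + ι (i == o) ≡⟨ xyz (d (α s (α t i))) _ _ ⟩
        d (α s (α t i)) + ι (i == o) + ι (α t i == o) ∎)
    }
    where
    open ≡-Reasoning
    xyz : ∀ x y z → x + y + z ≡ x + z + y
    xyz x y z = trans (+-assoc x y z) (trans (cong (x +_) (+-comm y z)) (sym (+-assoc x z y)))

  -- For a defect, `shift` at `o` says `d o = d (α o) + 1`. Since `α` swaps `o` and `α o`, `shift`
  -- at `α o` then needs the indicator of `o = j` to make up the missing unit.
  defect-reflection : ∀ t → Refl t → Defect t → j t ≡ o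
  defect-reflection t s ne = sym (==-sound (ι-positive (+-cancelˡ-≤ (d (α t o)) _ _ (begin
    d (α t o) + 1                ≡⟨ cong (λ b → d (α t o) + ι b) (sym (==-refl o)) ⟩
    d (α t o) + ι (o == o)       ≡⟨ sym (shift t o) ⟩
    d o + ι (α t o == j t)       ≡⟨ cong (λ b → d o + ι b) (==-false ne) ⟩
    d o + 0                      ≤⟨ +-monoʳ-≤ (d o) z≤n ⟩
    d o + ι (α t o == o)         ≡⟨ cong (λ k → d k + ι (α t o == o)) (sym (involutive t s o)) ⟩
    d (α t (α t o)) + ι (α t o == o) ≡⟨ sym (shift t (α t o)) ⟩
    d (α t o) + ι (α t (α t o) == j t) ≡⟨ cong (λ k → d (α t o) + ι (k == j t)) (involutive t s o) ⟩
    d (α t o) + ι (o == j t)     ∎))))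
    where open ≤-Reasoning

  -- Expanding d along ρ ∘ ρ′ = ρ′ ∘ ρ in both orders, all d-terms cancel and an identity between
  -- indicators remains; it is evaluated at ρ⁻¹(o).
  commutation : ∀ ρ ρ′ → Rot ρ → Rot ρ′ → ∀ i →
    ι (α ρ i == j ρ) + ι (α ρ′ (α ρ i) == j ρ′) + ι (α ρ′ i == o) ≡
    ι (α ρ′ i == j ρ′) + ι (α ρ (α ρ′ i) == j ρ) + ι (α ρ i == o)
  commutation ρ ρ′ r r′ i = +-cancelˡ-≡ (d i) _ _ (begin
    d i + (a + b + e′)         ≡⟨ solve 4 (λ x a b e → x :+ (a :+ b :+ e) := (x :+ a) :+ b :+ e) refl (d i) a b e′ ⟩
    (d i + a) + b + e′         ≡⟨ cong (λ x → x + b + e′) (shift ρ i) ⟩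
    (d (α ρ i) + z) + b + e′   ≡⟨ solve 4 (λ x z b e → (x :+ z) :+ b :+ e := (x :+ b) :+ (z :+ e)) refl (d (α ρ i)) z b e′ ⟩
    (d (α ρ i) + b) + (z + e′) ≡⟨ cong (_+ (z + e′)) (shift ρ′ (α ρ i)) ⟩
    (d (α ρ′ (α ρ i)) + e) + (z + e′) ≡⟨ cong (λ k → (d k + e) + (z + e′)) (rotations-commute {α ρ′} {α ρ} r′ r i) ⟩
    (d (α ρ (α ρ′ i)) + e) + (z + e′) ≡⟨ solve 4 (λ x e z e′ → (x :+ e) :+ (z :+ e′) := (x :+ e′) :+ (z :+ e)) refl (d (α ρ (α ρ′ i))) e z e′ ⟩
    (d (α ρ (α ρ′ i)) + e′) + (z + e) ≡⟨ cong (_+ (z + e)) (sym (shift ρ (α ρ′ i))) ⟩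
    (d (α ρ′ i) + b′) + (z + e) ≡⟨ solve 4 (λ x z b e → (x :+ b) :+ (z :+ e) := (x :+ z) :+ b :+ e) refl (d (α ρ′ i)) z b′ e ⟩
    (d (α ρ′ i) + z) + b′ + e  ≡⟨ cong (λ x → x + b′ + e) (sym (shift ρ′ i)) ⟩
    (d i + a′) + b′ + e        ≡⟨ solve 4 (λ x a b e → (x :+ a) :+ b :+ e := x :+ (a :+ b :+ e)) refl (d i) a′ b′ e ⟩
    d i + (a′ + b′ + e)        ∎)
    where
    open ≡-Reasoning
    open +-*-Solver
    a  = ι (α ρ i == j ρ)
    b  = ι (α ρ′ (α ρ i) == j ρ′)
    e′ = ι (α ρ′ i == o)
    a′ = ι (α ρ′ i == j ρ′)
    b′ = ι (α ρ (α ρ′ i) == j ρ)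
    e  = ι (α ρ i == o)
    z  = ι (i == o)

  -- At `i = ρ⁻¹(o)` the right side of `commutation` contains a 1. On the left, `ρ′ i = o` would
  -- make the rotations equal, so one of the other two indicators is 1.
  commutation-at-o : ∀ ρ ρ′ → Rot ρ → Rot ρ′ → α ρ o ≢ α ρ′ o → o ≡ j ρ ⊎ Symmetry ρ′
  commutation-at-o ρ ρ′ r r′ ne with rotation-surjective {α ρ} r o
  ... | i , p with o F.≟ j ρ | α ρ′ o F.≟ j ρ′
  ...   | yes e | _     = inj₁ e
  ...   | no  _ | yes e = inj₂ e
  ...   | no n₁ | no n₂ = contradiction (trans (commutation ρ ρ′ r r′ i) rhs) lhs
    where
    α′i≢o : α ρ′ i ≢ o
    α′i≢o e = ne (rot-ext {ρ} {ρ′} r r′ i (trans p (sym e)) o)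
    rhs : ι (α ρ′ i == j ρ′) + ι (α ρ (α ρ′ i) == j ρ) + ι (α ρ i == o) ≡ suc (ι (α ρ′ i == j ρ′) + ι (α ρ (α ρ′ i) == j ρ))
    rhs = trans (cong (λ b → ι (α ρ′ i == j ρ′) + ι (α ρ (α ρ′ i) == j ρ) + ι b) (==-true p)) (+-comm _ 1)
    lhs : ι (α ρ i == j ρ) + ι (α ρ′ (α ρ i) == j ρ′) + ι (α ρ′ i == o) ≢ suc (ι (α ρ′ i == j ρ′) + ι (α ρ (α ρ′ i) == j ρ))
    lhs rewrite p | ==-false n₁ | ==-false n₂ | ==-false α′i≢o = λ ()

  -- `commutation-at-o` is applied in both orders. As `ρ` is a defect, one order gives `j ρ′ = o`; a
  -- symmetry `ρ′` would then fix `o`, so the other order gives `j ρ = o`.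
  defect-rotations : ∀ ρ ρ′ → Rot ρ → Defect ρ → Rot ρ′ → α ρ′ o ≢ o → α ρ o ≢ α ρ′ o →
                     j ρ ≡ o × j ρ′ ≡ o
  defect-rotations ρ ρ′ r δ r′ nontrivial ne with commutation-at-o ρ′ ρ r′ r (ne ∘ sym) | commutation-at-o ρ ρ′ r r′ ne
  ... | inj₂ e | _      = contradiction e δ
  ... | inj₁ e | inj₁ e′ = sym e′ , sym e
  ... | inj₁ e | inj₂ e′ = contradiction (trans e′ (sym e)) nontrivial

  -- A rotation defect forces `j g = o` by `defect-rotations`, and `j g` is the image of `o` under
  -- the symmetry `g`. For a reflection defect `D`, both `D` and `g` after `D` are reflection
  -- defects; their moved units are at `o` and at `α g o`, and both must be at `o`.
  no-rotation-symmetry : ∀ D → Defect D → ∀ g → Rot g → Symmetry g → α g o ≡ o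
  no-rotation-symmetry D δ g r e with α g o F.≟ o | dihedral-α D
  ... | yes p | _ = p
  ... | no ne | inj₁ rD = contradiction (trans e (proj₂ (defect-rotations D g rD δ r ne distinct))) ne
    where
    distinct : α D o ≢ α g o
    distinct p = δ (trans p (trans e (sym (j-determined D g (rot-ext {D} {g} rD r o p)))))
  ... | no ne | inj₂ sD = contradiction
    (trans (cong (α g) (sym (defect-reflection D sD δ)))
           (defect-reflection (_after_ {g} e D) (rotation∘reflection {α g} {α D} r sD) (δ ∘ inj g))) ne

  -- Unless `t` is itself the rotation sought, it must be a reflection symmetry moving `o`.
  -- Composing it with `D` exchanges rotations and reflections, and `defect-reflection` on the
  -- reflection side locates the moved unit on the rotation side.
  rotation-defect : ∀ D → Defect D → ∀ t → j t ≢ o → Σ Shift λ ρ → Rot ρ × Defect ρ × j ρ ≢ o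
  rotation-defect D δ t ne with dihedral-α t | symmetry? t
  ... | inj₁ r | inj₁ e  = contradiction (trans (sym e) (no-rotation-symmetry D δ t r e)) ne
  ... | inj₁ r | inj₂ δt = t , r , δt , ne
  ... | inj₂ s | inj₂ δt = contradiction (defect-reflection t s δt) ne
  ... | inj₂ s | inj₁ e with dihedral-α D
  ...   | inj₁ rD = D , rD , δ , λ p → ne (trans (sym e) (trans (cong (α t) (sym p))
            (defect-reflection (_after_ {t} e D) (reflection∘rotation {α D} {α t} s rD) (δ ∘ inj t))))
  ...   | inj₂ sD = _after_ {t} e D , reflection∘reflection {α t} {α D} s sD , δ ∘ inj t ,
            λ p → ne (trans (sym e) (trans (cong (α t) (sym (defect-reflection D sD δ))) p))

  module FewShifts (ρ : Shift) (r : Rot ρ) (δ : Defect ρ) (jρ≢o : j ρ ≢ o) where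

    rotation-at-o : ∀ t → Rot t → α t o ≡ o ⊎ α t o ≡ α ρ o
    rotation-at-o t rt with α t o F.≟ o | α ρ o F.≟ α t o
    ... | yes e | _      = inj₁ e
    ... | no _  | yes e  = inj₂ (sym e)
    ... | no ne | no ne′ = contradiction (proj₁ (defect-rotations ρ t r δ rt ne ne′)) jρ≢o

    refl-cancel : ∀ s t → Refl s → α s (α t o) ≡ o → α s o ≡ α t o
    refl-cancel s t rs p = trans (cong (α s) (sym p)) (involutive s rs _)

    reflection-symmetries : ∀ s t → Refl s → Refl t → Symmetry s → Symmetry t → α s o ≡ α t o
    reflection-symmetries s t rs rt es et = refl-cancel s t rs
      (no-rotation-symmetry ρ δ (_after_ {s} es t) (reflection∘reflection {α s} {α t} rs rt) (cong (α s) et))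

    -- Both moved units are at `o`, so the product is a rotation in the scope of `rotation-at-o`. It
    -- cannot equal `ρ`, since its unit is at `o` and that of `ρ` is not; hence it fixes `o`.
    reflection-defects : ∀ s t → Refl s → Refl t → Defect s → Defect t → α s o ≡ α t o
    reflection-defects s t rs rt δs δt with rotation-at-o st rst
      where
      st = compose-at-o s t (defect-reflection s rs δs) (defect-reflection t rt δt)
      rst = reflection∘reflection {α s} {α t} rs rt
    ... | inj₁ p = refl-cancel s t rs p
    ... | inj₂ p = contradiction (sym (j-determined st ρ (rot-ext {st} {ρ} rst r o p))) jρ≢o
      where
      st = compose-at-o s t (defect-reflection s rs δs) (defect-reflection t rt δt)
      rst = reflection∘reflection {α s} {α t} rs rt

    -- The four possible maps: the identity, the rotation `ρ`, one reflection symmetry and one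
    -- reflection defect. This is the origin of the constant 4.
    Class : Fin 4 → Shift → Set
    Class zero t                   = Rot t × α t o ≡ o
    Class (suc zero) t             = Rot t × α t o ≡ α ρ o
    Class (suc (suc zero)) t       = Refl t × Symmetry t
    Class (suc (suc (suc zero))) t = Refl t × Defect t

    classify : ∀ t → ∃ λ k → Class k t
    classify t with dihedral-α t
    ... | inj₁ rt = [ (λ e → zero , rt , e) , (λ e → suc zero , rt , e) ]′ (rotation-at-o t rt)
    ... | inj₂ st = [ (λ e → suc (suc zero) , st , e) , (λ e → suc (suc (suc zero)) , st , e) ]′ (symmetry? t)

    class-determines : ∀ k s t → Class k s → Class k t → ∀ i → α s i ≡ α t i
    class-determines zero s t (rs , es) (rt , et) = rot-ext {s} {t} rs rt o (trans es (sym et))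
    class-determines (suc zero) s t (rs , es) (rt , et) = rot-ext {s} {t} rs rt o (trans es (sym et))
    class-determines (suc (suc zero)) s t (rs , es) (rt , et) =
      reflection-ext {α s} {α t} rs rt o (reflection-symmetries s t rs rt es et)
    class-determines (suc (suc (suc zero))) s t (rs , es) (rt , et) =
      reflection-ext {α s} {α t} rs rt o (reflection-defects s t rs rt es et)

    few : ∀ {q} (Λ : Fin q → Shift) → (∀ s t → (∀ i → α (Λ s) i ≡ α (Λ t) i) → s ≡ t) → q ≤ 4
    few {q} Λ distinct with q ≤? 4
    ... | yes h = h
    ... | no h with F.pigeonhole (≰⇒> h) (proj₁ ∘ classify ∘ Λ)
    ...   | s , t , s<t , e = contradiction
      (distinct s t (class-determines _ (Λ s) (Λ t) (proj₂ (classify (Λ s))) (subst (λ k → Class k (Λ t)) (sym e) (proj₂ (classify (Λ t))))))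
      (F.<⇒≢ s<t)

  all-at-o-or-few : ∀ D → Defect D → ∀ {q} (Λ : Fin q → Shift) →
    (∀ s t → (∀ i → α (Λ s) i ≡ α (Λ t) i) → s ≡ t) → (∀ t → j (Λ t) ≡ o) ⊎ q ≤ 4
  all-at-o-or-few D δ Λ distinct with F.all? (λ t → j (Λ t) F.≟ o)
  ... | yes h = inj₁ h
  ... | no h with F.¬∀⟶∃¬ _ _ (λ t → j (Λ t) F.≟ o) h
  ...   | t , ne with rotation-defect D δ (Λ t) ne
  ...     | ρ , r , δρ , ne′ = inj₂ (FewShifts.few ρ r δρ ne′ Λ distinct)

-- Weighing images of `o` and preimages of a degree-2 vertex against cycle degrees

module CountShifts {c′ : ℕ} (d : Fin (suc c′) → ℕ) (o : Fin (suc c′)) where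

  open Cyclic {c′}
  open CyclicWord d o
  open Shift

  module _ {q : ℕ} (Λ : Fin q → Shift) (fixes-o : ∀ t → j (Λ t) ≡ o)
           {ν : Fin (suc c′)} (dν : d ν ≡ 2) (x : Fin q → Fin (suc c′)) (αx : ∀ t → α (Λ t) (x t) ≡ ν)
           (x-inj : Injective _≡_ _≡_ x) (2≤d : ∀ i → 2 ≤ d i) (q≤do : q + 2 ≤ d o) (2≤q : 2 ≤ q) where

    private
      isRotation : Fin q → Bool
      isRotation t = [ (λ _ → true) , (λ _ → false) ]′ (dihedral-α (Λ t))

      same-image : ∀ s t → (∀ i → α (Λ s) i ≡ α (Λ t) i) → s ≡ t
      same-image s t e = x-inj (inj (Λ s) (trans (αx s) (sym (trans (e (x t)) (αx t)))))

      same-type : ∀ s t → isRotation s ≡ isRotation t → α (Λ s) o ≡ α (Λ t) o → s ≡ t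
      same-type s t e p with dihedral-α (Λ s) | dihedral-α (Λ t)
      ... | inj₁ r  | inj₁ r′ = same-image s t (rot-ext {Λ s} {Λ t} r r′ o p)
      ... | inj₂ r  | inj₂ r′ = same-image s t (reflection-ext {α (Λ s)} {α (Λ t)} r r′ o p)

      F₁ F₂ : Fin (suc c′) → ℕ
      F₁ i = sum (λ t → ι (i == α (Λ t) o))
      F₂ i = sum (λ t → ι (i == x t))

      -- The image of `o` determines a rotation, and likewise a reflection, so each kind reaches `i`
      -- at most once.
      F₁≤2 : ∀ i → F₁ i ≤ 2
      F₁≤2 i = begin
        F₁ i                        ≤⟨ sum-mono split ⟩
        sum (λ t → ι (R t) + ι (S t)) ≡⟨ ∑-distrib-+ (ι ∘ R) (ι ∘ S) ⟩
        sum (ι ∘ R) + sum (ι ∘ S)   ≤⟨ +-mono-≤ (count≤1 R R-unique) (count≤1 S S-unique) ⟩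
        2                           ∎
        where
        open ≤-Reasoning
        R S : Fin q → Bool
        R t = isRotation t ∧ (i == α (Λ t) o)
        S t = not (isRotation t) ∧ (i == α (Λ t) o)
        split : ∀ t → ι (i == α (Λ t) o) ≤ ι (R t) + ι (S t)
        split t with isRotation t
        ... | true  = m≤m+n _ 0
        ... | false = ≤-refl
        R-unique : ∀ s t → R s ≡ true → R t ≡ true → s ≡ t
        R-unique s t e e′ with isRotation s in es | isRotation t in et
        ... | true | true = same-type s t (trans es (sym et)) (trans (sym (==-sound {i = i} e)) (==-sound e′))
        S-unique : ∀ s t → S s ≡ true → S t ≡ true → s ≡ t
        S-unique s t e e′ with isRotation s in es | isRotation t in et
        ... | false | false = same-type s t (trans es (sym et)) (trans (sym (==-sound {i = i} e)) (==-sound e′))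

      F₂≤1 : ∀ i → F₂ i ≤ 1
      F₂≤1 i = count≤1 _ λ s t e e′ → x-inj (trans (sym (==-sound {i = i} e)) (==-sound e′))

      o≢ν : ν ≢ o
      o≢ν e = contradiction (≤-trans q≤do (≤-reflexive (trans (cong d (sym e)) dν))) (<⇒≱ (m<n+m 2 (≤-trans (s≤s z≤n) 2≤q)))

      d-x : ∀ t → d (x t) ≡ 2 + ι (x t == o)
      d-x t = begin
        d (x t)                               ≡⟨ sym (+-identityʳ _) ⟩
        d (x t) + 0                           ≡⟨ cong (λ b → d (x t) + ι b) (sym (==-false λ e → o≢ν (trans (sym (αx t)) (trans e (fixes-o t))))) ⟩
        d (x t) + ι (α (Λ t) (x t) == j (Λ t)) ≡⟨ shift (Λ t) (x t) ⟩
        d (α (Λ t) (x t)) + ι (x t == o)      ≡⟨ cong (λ k → d k + ι (x t == o)) (αx t) ⟩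
        d ν + ι (x t == o)                    ≡⟨ cong (_+ ι (x t == o)) dν ⟩
        2 + ι (x t == o)                      ∎
        where open ≡-Reasoning

      d-image : ∀ t → q + 1 + ι (α (Λ t) o == o) ≤ d (α (Λ t) o)
      d-image t = +-cancelʳ-≤ 1 _ _ (begin
        q + 1 + ι (α (Λ t) o == o) + 1       ≡⟨ solve 2 (λ q b → q :+ con 1 :+ b :+ con 1 := q :+ con 2 :+ b) refl q (ι (α (Λ t) o == o)) ⟩
        q + 2 + ι (α (Λ t) o == o)           ≤⟨ +-monoˡ-≤ _ q≤do ⟩
        d o + ι (α (Λ t) o == o)             ≡⟨ cong (λ k → d o + ι (α (Λ t) o == k)) (sym (fixes-o t)) ⟩
        d o + ι (α (Λ t) o == j (Λ t))       ≡⟨ shift (Λ t) o ⟩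
        d (α (Λ t) o) + ι (o == o)           ≡⟨ cong (λ b → d (α (Λ t) o) + ι b) (==-refl o) ⟩
        d (α (Λ t) o) + 1                    ∎)
        where
        open ≤-Reasoning
        open +-*-Solver

      -- The weights make both extreme cases equalities: an image of `o` may be hit twice and has
      -- degree at least `q + 1`, while a preimage of `ν` is hit once and has degree 2, each with
      -- one more if it is `o` itself. No vertex is of both kinds, because `2 ≤ q`.
      pointwise : ∀ i → q * F₁ i + 2 * F₂ i + (2 + 2 * ι (i == o)) ≤ 2 * d i
      pointwise i with F.any? (λ t → i F.≟ α (Λ t) o) | F.any? (λ t → i F.≟ x t)
      ... | yes (t , refl) | yes (s , e) = contradiction d-small (<⇒≱ d-big)
        where
        d-small : d (α (Λ t) o) ≤ 2 + ι (α (Λ t) o == o)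
        d-small = ≤-reflexive (subst (λ k → d k ≡ 2 + ι (k == o)) (sym e) (d-x s))
        d-big : 2 + ι (α (Λ t) o == o) < d (α (Λ t) o)
        d-big = ≤-trans (+-monoˡ-≤ _ (≤-trans (s≤s 2≤q) (≤-reflexive (+-comm 1 q)))) (d-image t)
      ... | yes (t , refl) | no none = begin
        q * F₁ (α (Λ t) o) + 2 * F₂ (α (Λ t) o) + (2 + 2 * b)     ≡⟨ cong (λ f → q * F₁ (α (Λ t) o) + 2 * f + (2 + 2 * b)) (sum-zero λ s → cong ι (==-false λ e → none (s , e))) ⟩
        q * F₁ (α (Λ t) o) + 2 * 0 + (2 + 2 * b)        ≤⟨ +-monoˡ-≤ _ (+-monoˡ-≤ _ (*-monoʳ-≤ q (F₁≤2 (α (Λ t) o)))) ⟩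
        q * 2 + 2 * 0 + (2 + 2 * b)           ≡⟨ solve 2 (λ q b → q :* con 2 :+ con 2 :* con 0 :+ (con 2 :+ con 2 :* b) := con 2 :* (q :+ con 1 :+ b)) refl q b ⟩
        2 * (q + 1 + b)                       ≤⟨ *-monoʳ-≤ 2 (d-image t) ⟩
        2 * d (α (Λ t) o)                     ∎
        where
        open ≤-Reasoning
        open +-*-Solver
        b = ι (α (Λ t) o == o)
      ... | no none | yes (s , refl) = begin
        q * F₁ (x s) + 2 * F₂ (x s) + (2 + 2 * b)     ≡⟨ cong (λ f → q * f + 2 * F₂ (x s) + (2 + 2 * b)) (sum-zero λ s → cong ι (==-false λ e → none (s , e))) ⟩
        q * 0 + 2 * F₂ (x s) + (2 + 2 * b)        ≤⟨ +-monoˡ-≤ _ (+-monoʳ-≤ (q * 0) (*-monoʳ-≤ 2 (F₂≤1 (x s)))) ⟩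
        q * 0 + 2 * 1 + (2 + 2 * b)           ≡⟨ solve 2 (λ q b → q :* con 0 :+ con 2 :* con 1 :+ (con 2 :+ con 2 :* b) := con 2 :* (con 2 :+ b)) refl q b ⟩
        2 * (2 + b)                           ≡⟨ cong (2 *_) (sym (d-x s)) ⟩
        2 * d (x s)                           ∎
        where
        open ≤-Reasoning
        open +-*-Solver
        b = ι (x s == o)
      ... | no none | no none′ = begin
        q * F₁ i + 2 * F₂ i + (2 + 2 * ι (i == o)) ≡⟨ cong₂ (λ f g → q * f + 2 * g + (2 + 2 * ι (i == o)))
                                                        (sum-zero λ s → cong ι (==-false λ e → none (s , e)))
                                                        (sum-zero λ s → cong ι (==-false λ e → none′ (s , e))) ⟩
        q * 0 + 2 * 0 + (2 + 2 * ι (i == o))  ≤⟨ +-monoʳ-≤ (q * 0 + 2 * 0) (+-monoʳ-≤ 2 (*-monoʳ-≤ 2 (ι≤1 (i == o)))) ⟩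
        q * 0 + 2 * 0 + (2 + 2 * 1)           ≡⟨ cong (λ k → k + 2 * 0 + 4) (*-zeroʳ q) ⟩
        4                                     ≤⟨ *-monoʳ-≤ 2 (2≤d i) ⟩
        2 * d i                               ∎
        where open ≤-Reasoning

    weight-bound : q * q + 2 * q + (2 * suc c′ + 2) ≤ 2 * sum d
    weight-bound = begin
      q * q + 2 * q + (2 * suc c′ + 2)   ≡⟨ cong₂ (λ a b → q * a + 2 * b + (2 * suc c′ + 2)) (sym (sum-fibres (λ t → α (Λ t) o))) (sym (sum-fibres x)) ⟩
      q * sum F₁ + 2 * sum F₂ + (2 * suc c′ + 2)
        ≡⟨ cong₂ _+_ (cong₂ _+_ (*-distribˡ-sum q F₁) (*-distribˡ-sum 2 F₂))
             (cong₂ _+_ (trans (*-comm 2 (suc c′)) (sym (sum-const (suc c′) 2)))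
                        (trans (cong (2 *_) (sym (sum-== o))) (*-distribˡ-sum 2 (λ i → ι (i == o))))) ⟩
      sum (λ i → q * F₁ i) + sum (λ i → 2 * F₂ i) + (sum (λ (_ : Fin (suc c′)) → 2) + sum (λ i → 2 * ι (i == o)))
        ≡⟨ cong₂ _+_ (sym (∑-distrib-+ (λ i → q * F₁ i) (λ i → 2 * F₂ i))) (sym (∑-distrib-+ (λ (_ : Fin (suc c′)) → 2) (λ i → 2 * ι (i == o)))) ⟩
      sum (λ i → q * F₁ i + 2 * F₂ i) + sum (λ i → 2 + 2 * ι (i == o))
        ≡⟨ sym (∑-distrib-+ (λ i → q * F₁ i + 2 * F₂ i) (λ i → 2 + 2 * ι (i == o))) ⟩
      sum (λ i → q * F₁ i + 2 * F₂ i + (2 + 2 * ι (i == o))) ≤⟨ sum-mono pointwise ⟩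
      sum (λ i → 2 * d i)                ≡⟨ sym (*-distribˡ-sum 2 d) ⟩
      2 * sum d                          ∎
      where open ≤-Reasoning

-- Sunshine graphs

record CycleSkeleton (G : Graph n) (c′ : ℕ) : Set where
  open Cyclic {c′}
  field
    p          : Fin (suc c′) → Fin n
    p-inj      : Injective _≡_ _≡_ p
    3≤c        : 3 ≤ suc c′
    p-skel     : ∀ i → InSkel G (p i)
    p-onto     : ∀ {x} → InSkel G x → ∃ λ i → p i ≡ x
    p-next     : ∀ i → p i ∼[ G ] p (next i)
    p-adjacent : ∀ i k → p i ∼[ G ] p k → k ≡ next i ⊎ k ≡ prev i

  p-prev : ∀ i → p i ∼[ G ] p (prev i)
  p-prev i = ∼-sym G (subst (λ k → p (prev i) ∼[ G ] p k) (next-prev i) (p-next (prev i)))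

cycleSkeleton : ∀ (G : Graph n) → SkeletonIsCycle G → ∃ (CycleSkeleton G)
cycleSkeleton G (zero , p , () , _)
cycleSkeleton G (suc c′ , p , 3≤c , inj , skel , adjacent) = c′ , record
  { p = p ; p-inj = inj ; 3≤c = 3≤c
  ; p-skel = λ i → Equivalence.from (skel (p i)) (i , refl)
  ; p-onto = λ {x} → Equivalence.to (skel x)
  ; p-next = λ i → Equivalence.from (adjacent i (next i)) (inj₁ (CycSucc-next i))
  ; p-adjacent = λ i k e → [ (λ s → inj₁ (CycSucc-functional s (CycSucc-next i))) ,
                             (λ s → inj₂ (CycSucc-injective s (CycSucc-prev i))) ]′ (Equivalence.to (adjacent i k) e)
  }
  where open Cyclic {c′}

module SunshineGraph (G : Graph n) (conn : Connected G) {c′ : ℕ} (S : CycleSkeleton G c′) where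

  open Cyclic {c′}
  open CycleSkeleton S

  d : Fin (suc c′) → ℕ
  d i = deg G (p i)

  abstract
    leaf-neighbour-on-cycle : ∀ {x} → deg G x ≡ 1 → ∃ λ i → p i ∼[ G ] x
    leaf-neighbour-on-cycle {x} dx with neighbour-exists G (≤-reflexive (sym dx))
    ... | z , e with p-onto (leaf-neighbour-skel G conn (p-skel zero) e (λ h → 1+n≰n (subst (2 ≤_) dx h)))
    ...   | i , refl = i , ∼-sym G e

  leaf-adjacency : ∀ {x i} → deg G x ≡ 1 → p i ∼[ G ] x → ∀ k → adj G (p k) x ≡ (k == i)
  leaf-adjacency {x} {i} dx e k = bool-ext
    (λ h → ==-true (p-inj (leaf-unique G (λ h → 1+n≰n (subst (2 ≤_) dx h)) (∼-sym G h) (∼-sym G e))))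
    (λ h → subst (λ a → p a ∼[ G ] x) (sym (==-sound {i = k} h)) e)

  -- Double counting: a vertex has at most two neighbours on the cycle, and at most one if it is a leaf.
  degrees-on-cycle : sum d ≤ n + suc c′
  degrees-on-cycle = begin
    sum d                                             ≡⟨ sum-cong-≗ (λ i → deg-sum G (p i)) ⟩
    sum (λ i → sum (λ z → ι (adj G (p i) z)))         ≡⟨ ∑-comm (λ i z → ι (adj G (p i) z)) ⟩
    sum (λ z → sum (λ i → ι (adj G (p i) z)))         ≤⟨ sum-mono pointwise ⟩
    sum (λ z → 1 + sum (λ i → ι (z == p i)))          ≡⟨ ∑-distrib-+ (λ _ → 1) (λ z → sum (λ i → ι (z == p i))) ⟩
    sum {n} (λ _ → 1) + sum (λ z → sum (λ i → ι (z == p i))) ≡⟨ cong₂ _+_ (trans (sum-const n 1) (*-identityʳ n)) (sum-fibres p) ⟩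
    n + suc c′                                        ∎
    where
    open ≤-Reasoning
    pointwise : ∀ z → sum (λ i → ι (adj G (p i) z)) ≤ 1 + sum (λ i → ι (z == p i))
    pointwise z with skel? G z
    ... | no h = ≤-trans (count≤1 _ λ i k e e′ → p-inj (leaf-unique G h (∼-sym G e) (∼-sym G e′))) (m≤m+n 1 _)
    ... | yes h with p-onto h
    ...   | k , refl = begin
      sum (λ i → ι (adj G (p i) (p k)))                     ≤⟨ sum-mono two ⟩
      sum (λ i → ι (i == next k) + ι (i == prev k))         ≡⟨ ∑-distrib-+ (λ i → ι (i == next k)) (λ i → ι (i == prev k)) ⟩
      sum (λ i → ι (i == next k)) + sum (λ i → ι (i == prev k)) ≡⟨ cong₂ _+_ (sum-== (next k)) (sum-== (prev k)) ⟩
      2                                                     ≤⟨ s≤s (≤-trans (≤-reflexive (sym (cong ι (==-refl (p k))))) (term≤sum k (λ i → ι (p k == p i)))) ⟩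
      1 + sum (λ i → ι (p k == p i))                        ∎
      where
      two : ∀ i → ι (adj G (p i) (p k)) ≤ ι (i == next k) + ι (i == prev k)
      two i with adj G (p i) (p k) in eq
      ... | false = z≤n
      ... | true with p-adjacent k i (∼-sym G eq)
      ...   | inj₁ refl = ≤-trans (≤-reflexive (cong ι (sym (==-refl (next k))))) (m≤m+n _ _)
      ...   | inj₂ refl = ≤-trans (≤-reflexive (cong ι (sym (==-refl (prev k))))) (m≤n+m _ _)

  module Leaf (w : Fin n) (dw : deg G w ≡ 1) where

    o : Fin (suc c′)
    o = proj₁ (leaf-neighbour-on-cycle dw)

    o∼w : p o ∼[ G ] w
    o∼w = proj₂ (leaf-neighbour-on-cycle dw)

    open CyclicWord d o
    open Shift

    p≢w : ∀ i → p i ≢ w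
    p≢w i e = 1+n≰n (subst (2 ≤_) (trans (cong (deg G) e) dw) (p-skel i))

    abstract
      -- Source and target are the same graph, so deleting `w` and deleting its image remove equally
      -- many edges.
      image-leaf : ∀ (π : Permutation′ n) → IsoOff w π G G → deg G (π ⟨$⟩ʳ w) ≡ 1
      image-leaf π h = trans (sym (*-cancelˡ-≡ _ _ 2 (+-cancelˡ-≡ (degreeSum G) _ _ (degreeSum-isoOff G G π h)))) dw

    module _ (π : Permutation′ n) (h : IsoOff w π G G) where

      private
        on-cycle : ∀ i → ∃ λ k → p k ≡ π ⟨$⟩ʳ p i
        on-cycle i = p-onto (two-neighbours G
          (trans (h (p i) (p (next i)) (p≢w _) (p≢w _)) (p-next i))
          (trans (h (p i) (p (prev i)) (p≢w _) (p≢w _)) (p-prev i))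
          (λ e → next≢prev 3≤c i (p-inj (perm-inj π e))))

        a : Fin (suc c′) → Fin (suc c′)
        a i = proj₁ (on-cycle i)

        p∘a : ∀ i → p (a i) ≡ π ⟨$⟩ʳ p i
        p∘a i = proj₂ (on-cycle i)

        a-inj : Injective _≡_ _≡_ a
        a-inj {i} {k} e = p-inj (perm-inj π (trans (sym (p∘a i)) (trans (cong p e) (p∘a k))))

        home : ∃ λ k → p k ∼[ G ] (π ⟨$⟩ʳ w)
        home = leaf-neighbour-on-cycle (image-leaf π h)

      abstract
        -- The image of a cycle vertex keeps two distinct neighbours and therefore lies on the cycle
        -- again. The index `j` is where the leaf `π w` hangs, and `shift` is `deg-isoOff` with its
        -- indicators evaluated by `leaf-adjacency`.
        toShift : Shift
        toShift = record
          { α = a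
          ; j = proj₁ home
          ; inj = a-inj
          ; dihedral-α = dihedral 3≤c a-inj λ i → p-adjacent (a i) (a (next i))
              (trans (cong₂ (adj G) (p∘a i) (p∘a (next i))) (trans (h _ _ (p≢w _) (p≢w _)) (p-next i)))
          ; shift = λ i → sym (trans
              (cong₂ _+_ (cong (deg G) (p∘a i)) (cong ι (sym (leaf-adjacency dw o∼w i))))
              (trans (deg-isoOff G G π h (p i) (p≢w i))
                (cong (λ b → d i + ι b) (trans (cong (λ z → adj G z (π ⟨$⟩ʳ w)) (sym (p∘a i)))
                                               (leaf-adjacency (image-leaf π h) (proj₂ home) (a i))))))
          }

        toShift-α : ∀ i → p (α toShift i) ≡ π ⟨$⟩ʳ p i
        toShift-α = p∘a

        toShift-j : p (j toShift) ∼[ G ] (π ⟨$⟩ʳ w)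
        toShift-j = proj₂ home

      private
        adjacent-to-image : Symmetry toShift → ∀ z → adj G (π ⟨$⟩ʳ z) (π ⟨$⟩ʳ w) ≡ adj G z w
        adjacent-to-image e z = bool-ext
          (λ k → subst (λ z → z ∼[ G ] w) (sym (perm-inj π (trans (leaf-unique G (leaf (image-leaf π h)) (∼-sym G k) (∼-sym G toShift-j)) o-image))) o∼w)
          (λ k → subst (λ z → (π ⟨$⟩ʳ z) ∼[ G ] (π ⟨$⟩ʳ w)) (leaf-unique G (leaf dw) (∼-sym G o∼w) (∼-sym G k))
                   (subst (λ z → z ∼[ G ] (π ⟨$⟩ʳ w)) o-image toShift-j))
          where
          leaf : ∀ {x} → deg G x ≡ 1 → ¬ InSkel G x
          leaf dx h = 1+n≰n (subst (2 ≤_) dx h)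
          o-image : p (j toShift) ≡ π ⟨$⟩ʳ p o
          o-image = trans (cong p (sym e)) (toShift-α o)

      -- Only the edge at `w` is in question; it is preserved because the neighbour of `w` is sent
      -- to the neighbour of `π w`.
      symmetry⇒iso : Symmetry toShift → IsIsoBy π G G
      symmetry⇒iso e x y with x F.≟ w | y F.≟ w
      ... | yes refl | yes refl = trans (adj-irrefl G _) (sym (adj-irrefl G _))
      ... | no x≢w   | no y≢w   = h x y x≢w y≢w
      ... | yes refl | no _     = trans (adj-sym G _ _) (trans (adjacent-to-image e y) (adj-sym G y w))
      ... | no _     | yes refl = adjacent-to-image e x

  module Core (w v : Fin n) (dw : deg G w ≡ 1) (dv : deg G v ≡ 2)
              (π⋆ : Permutation′ n) (h⋆ : IsoOff w π⋆ G G) (¬iso : ¬ IsIsoBy π⋆ G G)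
              {q : ℕ} (Π : Fin q → Permutation′ n) (hΠ : ∀ t → IsoOff w (Π t) G G)
              (v-distinct : Injective _≡_ _≡_ (λ t → Π t ⟨$⟩ˡ v))
              (w-distinct : Injective _≡_ _≡_ (λ t → Π t ⟨$⟩ʳ w)) where

    open Leaf w dw
    open CyclicWord d o
    open Shift

    private
      Λ : Fin q → Shift
      Λ t = toShift (Π t) (hΠ t)

      ν : ∃ λ i → p i ≡ v
      ν = p-onto (≤-reflexive (sym dv))

      preimage : ∀ t → ∃ λ i → α (Λ t) i ≡ proj₁ ν
      preimage t = dihedral-surjective {α (Λ t)} (dihedral-α (Λ t)) (proj₁ ν)

      p-preimage : ∀ s i → α (Λ s) i ≡ proj₁ ν → p i ≡ Π s ⟨$⟩ˡ v
      p-preimage s i e = trans (sym (inverseˡ (Π s)))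
        (cong (Π s ⟨$⟩ˡ_) (trans (sym (toShift-α (Π s) (hΠ s) i)) (trans (cong p e) (proj₂ ν))))

      distinct : ∀ s t → (∀ i → α (Λ s) i ≡ α (Λ t) i) → s ≡ t
      distinct s t e = v-distinct (trans (sym (p-preimage s i (proj₂ (preimage s))))
        (p-preimage t i (trans (sym (e i)) (proj₂ (preimage s)))))
        where i = proj₁ (preimage s)

      -- The `q` distinct leaves `Π t w` all hang at `p o`, and the two cycle neighbours account for
      -- the remaining 2.
      leaves-at-o : (∀ t → j (Λ t) ≡ o) → q + 2 ≤ d o
      leaves-at-o fixes-o = begin
        q + 2                          ≡⟨ sym (+-assoc q 1 1) ⟩
        q + 1 + 1                      ≡⟨ sym (cong (λ k → k + 1 + 1) (sum-fibres y)) ⟩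
        sum f + 1 + 1                  ≡⟨ sym (cong (_+ 1) (sum-add-point f (p (next o)))) ⟩
        sum f₁ + 1                     ≡⟨ sym (sum-add-point f₁ (p (prev o))) ⟩
        sum (λ z → f₁ z + ι (z == p (prev o))) ≤⟨ sum-mono (add-point P f₁ _ (add-point P f _ base (off (next o)) (p-next o)) disjoint (p-prev o)) ⟩
        sum (ι ∘ P)                    ≡⟨ sym (deg-sum G (p o)) ⟩
        d o                            ∎
        where
        open ≤-Reasoning
        y : Fin q → Fin n
        y t = Π t ⟨$⟩ʳ w
        P = adj G (p o)
        f f₁ : Fin n → ℕ
        f z = sum (λ t → ι (z == y t))
        f₁ z = f z + ι (z == p (next o))
        base : ∀ z → f z ≤ ι (P z)
        base = fibres≤ y w-distinct P λ t → subst (λ k → p k ∼[ G ] y t) (fixes-o t) (toShift-j (Π t) (hΠ t))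
        off : ∀ i → f (p i) ≡ 0
        off i = sum-zero λ t → cong ι (==-false {i = p i} λ e → 1+n≰n (subst (2 ≤_) (trans (cong (deg G) e) (image-leaf (Π t) (hΠ t))) (p-skel i)))
        disjoint : f₁ (p (prev o)) ≡ 0
        disjoint = cong₂ _+_ (off (prev o)) (cong ι (==-false {i = p (prev o)} λ e → next≢prev 3≤c o (sym (p-inj e))))

    bound : q ≤ 4 ⊎ suc q * suc q + 1 ≤ 2 * n
    bound with all-at-o-or-few (toShift π⋆ h⋆) (λ e → ¬iso (symmetry⇒iso π⋆ h⋆ e)) Λ distinct
    ... | inj₂ h = inj₁ h
    ... | inj₁ fixes-o with 2 ≤? q
    ...   | no h = inj₁ (≤-trans (≤-pred (≰⇒> h)) (s≤s z≤n))
    -- The term `2 * suc c′` on both sides absorbs the degree 2 that each vertex has within the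
    -- cycle.
    ...   | yes 2≤q = inj₂ (+-cancelʳ-≤ (2 * suc c′) _ _ (begin
      suc q * suc q + 1 + 2 * suc c′      ≡⟨ solve 2 (λ q c → (con 1 :+ q) :* (con 1 :+ q) :+ con 1 :+ con 2 :* c := q :* q :+ con 2 :* q :+ (con 2 :* c :+ con 2)) refl q (suc c′) ⟩
      q * q + 2 * q + (2 * suc c′ + 2)    ≤⟨ CountShifts.weight-bound d o Λ fixes-o (trans (cong (deg G) (proj₂ ν)) dv)
                                               (λ t → proj₁ (preimage t)) (λ t → proj₂ (preimage t)) x-inj p-skel (leaves-at-o fixes-o) 2≤q ⟩
      2 * sum d                           ≤⟨ *-monoʳ-≤ 2 degrees-on-cycle ⟩
      2 * (n + suc c′)                    ≡⟨ *-distribˡ-+ 2 n (suc c′) ⟩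
      2 * n + 2 * suc c′                  ∎))
      where
      open ≤-Reasoning
      open +-*-Solver
      x-inj : Injective _≡_ _≡_ (λ t → proj₁ (preimage t))
      x-inj {s} {t} e = v-distinct (trans (sym (p-preimage s _ (proj₂ (preimage s)))) (trans (cong p e) (p-preimage t _ (proj₂ (preimage t)))))

-- Gluing a supercard

transpose-left : ∀ (i j : Fin n) → transpose i j ⟨$⟩ʳ i ≡ j
transpose-left i j rewrite ==-refl i = refl

transpose-right : ∀ (i j : Fin n) → transpose i j ⟨$⟩ʳ j ≡ i
transpose-right i j with j F.≟ i
... | yes e = e
... | no _ rewrite ==-refl j = refl

transpose-other : ∀ {i j k : Fin n} → k ≢ i → k ≢ j → transpose i j ⟨$⟩ʳ k ≡ k
transpose-other {i = i} {j} {k} n₁ n₂ rewrite ==-false n₁ | ==-false n₂ = refl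

-- With the new vertex at `zero`, deleting it gives back the adjacency of `H` by computation.
addVertex : Graph n → (Fin n → Bool) → Graph (suc n)
addVertex H F = record { adj = a ; sym = s ; irrefl = r }
  where
  a : Fin _ → Fin _ → Bool
  a zero    zero    = false
  a zero    (suc z) = F z
  a (suc z) zero    = F z
  a (suc x) (suc y) = adj H x y
  s : ∀ i j → a i j ≡ a j i
  s zero    zero    = refl
  s zero    (suc z) = refl
  s (suc z) zero    = refl
  s (suc x) (suc y) = adj-sym H x y
  r : ∀ i → a i i ≡ false
  r zero    = refl
  r (suc z) = adj-irrefl H z

deg-new : ∀ (H : Graph n) F → deg (addVertex H F) zero ≡ sum (ι ∘ F)
deg-new H F = deg-sum (addVertex H F) zero

deg-old : ∀ (H : Graph n) F z → deg (addVertex H F) (suc z) ≡ ι (F z) + deg H z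
deg-old H F z = trans (deg-sum (addVertex H F) (suc z)) (cong (ι (F z) +_) (sym (deg-sum H z)))

addLeaf : Graph n → Fin n → Graph (suc n)
addLeaf H u = addVertex H (_== u)

addLeaf-skel : ∀ (H : Graph n) {u} → InSkel H u → ∀ z → InSkel (addLeaf H u) (suc z) ⇔ InSkel H z
addLeaf-skel H {u} hu z = mk⇔ to (λ h → ≤-trans h (≤-trans (m≤n+m _ _) (≤-reflexive (sym (deg-old H (_== u) z)))))
  where
  to : InSkel (addLeaf H u) (suc z) → InSkel H z
  to h with z F.≟ u | deg-old H (_== u) z
  ... | yes refl | _ = hu
  ... | no ne    | e = subst (2 ≤_) e h

deg-addLeaf-new : ∀ (H : Graph n) u → deg (addLeaf H u) zero ≡ 1
deg-addLeaf-new H u = trans (deg-new H (_== u)) (sum-== u)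

addLeaf-sunshine : ∀ (H : Graph n) {u} → InSkel H u → Sunshine H → Sunshine (addLeaf H u)
addLeaf-sunshine H {u} hu (conn , k , p , 3≤k , inj , skel , adjacent) =
  conn⁺ , k , suc ∘ p , 3≤k , inj ∘ F.suc-injective , skel⁺ , adjacent
  where
  H⁺ = addLeaf H u
  old : ∀ {x y} → Reach H x y → Reach H⁺ (suc x) (suc y)
  old here       = here
  old (step e r) = step e (old r)
  snoc : ∀ {x y z} → Reach H⁺ x y → y ∼[ H⁺ ] z → Reach H⁺ x z
  snoc here       e = step e here
  snoc (step d r) e = step d (snoc r e)
  conn⁺ : Connected H⁺
  conn⁺ zero    zero    = here
  conn⁺ zero    (suc y) = step (==-refl u) (old (conn u y))
  conn⁺ (suc x) zero    = snoc (old (conn x u)) (==-refl u)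
  conn⁺ (suc x) (suc y) = old (conn x y)
  skel⁺ : ∀ x → InSkel H⁺ x ⇔ ∃ λ i → suc (p i) ≡ x
  skel⁺ zero    = mk⇔ (λ h → contradiction (subst (2 ≤_) (deg-addLeaf-new H u) h) λ { (s≤s ()) }) λ { (_ , ()) }
  skel⁺ (suc z) = mk⇔
    (λ h → let i , e = Equivalence.to (skel z) (Equivalence.to (addLeaf-skel H hu z) h) in i , cong suc e)
    (λ { (i , e) → Equivalence.from (addLeaf-skel H hu z) (Equivalence.from (skel z) (i , F.suc-injective e)) })

-- Separated families and their maximal extensions

record Separated {U T : Graph (suc m)} (C : SunSuper U T) (size : ℕ) (Λ : Fin size → Permutation′ (suc (suc m))) : Set where
  field
    inB      : ∀ i → Bvw C (Λ i)
    hasId    : ∃ λ i → ∀ x → Λ i ⟨$⟩ʳ x ≡ x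
    separate : ∀ i j → i ≢ j → (Λ i ⟨$⟩ˡ v C ≢ Λ j ⟨$⟩ˡ v C) × (Λ i ⟨$⟩ʳ w C ≢ Λ j ⟨$⟩ʳ w C)

module _ {U T : Graph (suc m)} (C : SunSuper U T) {k : ℕ} where

  open Separated

  separated-size : ∀ {size Λ} → Separated C size Λ → size ≤ suc (suc m)
  separated-size {size} {Λ} X = F.injective⇒≤ {f = λ i → Λ i ⟨$⟩ʳ w C} inj
    where
    inj : Injective _≡_ _≡_ (λ i → Λ i ⟨$⟩ʳ w C)
    inj {i} {j} e with i F.≟ j
    ... | yes p = p
    ... | no ne = contradiction e (proj₂ (separate X i j ne))

  -- If no saturating set of the required kind exists, the family at hand is shown to be maximal:
  -- any map it could take in would lead to a larger family, refuted recursively. The images of `w`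
  -- are distinct, so a size of `3 + m` is impossible and the recursion ends.
  extend-saturating : ∀ fuel {size Λ} (X : Separated C size Λ) → fuel + size ≡ 3 + m →
    (f : Fin k → Fin size) → Injective _≡_ _≡_ f → (∀ t → BU C (Λ (f t))) → ¬ ¬ ChiAtLeast C k
  extend-saturating zero X refl f inj bu _ = 1+n≰n (separated-size X)
  extend-saturating (suc fuel) {size} {Λ} X e f inj bu no-chi = no-chi
    (record { size = size ; Λ = Λ ; inB = inB X ; hasId = hasId X ; separate = separate X ; maximal = max } , f , inj , bu)
    where
    max : ∀ σ → Bvw C σ → (∀ i → ¬ (∀ x → σ ⟨$⟩ʳ x ≡ Λ i ⟨$⟩ʳ x)) →
          ∃ λ i → (Λ i ⟨$⟩ˡ v C ≡ σ ⟨$⟩ˡ v C) ⊎ (Λ i ⟨$⟩ʳ w C ≡ σ ⟨$⟩ʳ w C)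
    max σ σB _ with F.any? (λ i → (Λ i ⟨$⟩ˡ v C F.≟ σ ⟨$⟩ˡ v C) ⊎-dec (Λ i ⟨$⟩ʳ w C F.≟ σ ⟨$⟩ʳ w C))
    ... | yes h = h
    ... | no h = ⊥-elim (extend-saturating fuel X⁺ (trans (+-suc fuel size) e) (suc ∘ f) (inj ∘ F.suc-injective) bu no-chi)
      where
      Λ⁺ : Fin (suc size) → Permutation′ (suc (suc m))
      Λ⁺ zero    = σ
      Λ⁺ (suc i) = Λ i
      X⁺ : Separated C (suc size) Λ⁺
      inB X⁺ zero    = σB
      inB X⁺ (suc i) = inB X i
      hasId X⁺ = let i , idi = hasId X in suc i , idi
      separate X⁺ zero    zero    ne = contradiction refl ne
      separate X⁺ zero    (suc j) _  = (λ e → h (j , inj₁ (sym e))) , (λ e → h (j , inj₂ (sym e)))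
      separate X⁺ (suc i) zero    _  = (λ e → h (i , inj₁ e)) , (λ e → h (i , inj₂ e))
      separate X⁺ (suc i) (suc j) ne = separate X i j (ne ∘ cong suc)

  separated⇒chi : ∀ {Λ} → Separated C k Λ → (∀ t → BU C (Λ t)) → ¬ ¬ ChiAtLeast C k
  separated⇒chi X bu = extend-saturating (3 + m ∸ k) X (m∸n+n≡m (≤-trans (separated-size X) (n≤1+n _))) id id bu

-- `F` is the neighbourhood prescribed in T for the vertex to be added; `at-x` says that this vertex
-- takes over the role of the deleted `x`.
record Member (U T : Graph (suc m)) (F : Fin (suc m) → Bool) : Set where
  field
    x y    : Fin (suc m)
    π      : Permutation′ (suc m)
    πx     : π ⟨$⟩ʳ x ≡ y
    off    : IsoOff x π U T
    at-x   : ∀ z → z ≢ x → F (π ⟨$⟩ʳ z) ≡ adj U x z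

module _ {U T : Graph (suc m)} {F : Fin (suc m) → Bool} (M : Member U T F) where
  open Member M

  -- From U with a new leaf to T with a new vertex: the leaf goes to `y`, `x` goes to the new
  -- vertex, and all else follows `π`.
  Ψ : Permutation′ (suc (suc m))
  Ψ = lift₀ π ∘ₚ transpose zero (suc y)

  Ψ-zero : Ψ ⟨$⟩ʳ zero ≡ suc y
  Ψ-zero = transpose-left zero (suc y)

  Ψ-x : Ψ ⟨$⟩ʳ suc x ≡ zero
  Ψ-x = trans (cong (λ z → transpose zero (suc y) ⟨$⟩ʳ suc z) πx) (transpose-right zero (suc y))

  Ψ-other : ∀ {z} → z ≢ x → Ψ ⟨$⟩ʳ suc z ≡ suc (π ⟨$⟩ʳ z)
  Ψ-other {z} ne = transpose-other {i = zero} {suc y} {suc (π ⟨$⟩ʳ z)} (λ ()) λ e → ne (perm-inj π (trans (F.suc-injective e) (sym πx)))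

  Ψ-off : ∀ a b → adj (addVertex T F) (Ψ ⟨$⟩ʳ suc a) (Ψ ⟨$⟩ʳ suc b) ≡ adj U a b
  Ψ-off a b with a F.≟ x | b F.≟ x
  ... | yes refl | yes refl = trans (adj-irrefl (addVertex T F) (Ψ ⟨$⟩ʳ suc x)) (sym (adj-irrefl U x))
  ... | yes refl | no b≢x   = trans (cong₂ (adj (addVertex T F)) Ψ-x (Ψ-other b≢x)) (at-x b b≢x)
  ... | no a≢x   | yes refl = trans (cong₂ (adj (addVertex T F)) (Ψ-other a≢x) Ψ-x) (trans (at-x a a≢x) (adj-sym U x a))
  ... | no a≢x   | no b≢x   = trans (cong₂ (adj (addVertex T F)) (Ψ-other a≢x) (Ψ-other b≢x)) (off a b a≢x b≢x)

  -- Adds the edges at the new leaf to `Ψ-off`. It is applied to one member only, since elements of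
  -- B_U need not respect the edge at `w`.
  Ψ-iso : F y ≡ false → ∀ {u} → u ≢ x → (∀ z → z ≢ x → adj T y (π ⟨$⟩ʳ z) ≡ (z == u)) →
          IsIsoBy Ψ (addLeaf U u) (addVertex T F)
  Ψ-iso Fy {u} u≢x at-y = iso
    where
    at-zero : ∀ b → adj (addVertex T F) (Ψ ⟨$⟩ʳ zero) (Ψ ⟨$⟩ʳ suc b) ≡ (b == u)
    at-zero b with b F.≟ x
    ... | yes refl = trans (cong₂ (adj (addVertex T F)) Ψ-zero Ψ-x) (trans Fy (sym (==-false (u≢x ∘ sym))))
    ... | no b≢x   = trans (cong₂ (adj (addVertex T F)) Ψ-zero (Ψ-other b≢x)) (at-y b b≢x)
    iso : IsIsoBy Ψ (addLeaf U u) (addVertex T F)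
    iso zero    zero    = adj-irrefl (addVertex T F) (Ψ ⟨$⟩ʳ zero)
    iso zero    (suc b) = at-zero b
    iso (suc a) zero    = trans (adj-sym (addVertex T F) (Ψ ⟨$⟩ʳ suc a) (Ψ ⟨$⟩ʳ zero)) (at-zero a)
    iso (suc a) (suc b) = Ψ-off a b

module Supercard {U T : Graph (suc m)} (sunU : Sunshine U) {F : Fin (suc m) → Bool} {k : ℕ}
                 (M : Fin (suc k) → Member U T F)
                 (x-inj : Injective _≡_ _≡_ (Member.x ∘ M)) (y-inj : Injective _≡_ _≡_ (Member.y ∘ M))
                 (Fy : F (Member.y (M zero)) ≡ false) (dx : deg U (Member.x (M zero)) ≡ 2)
                 {u : Fin (suc m)} (u-skel : InSkel U u) (u≢x : u ≢ Member.x (M zero))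
                 (at-y : ∀ z → z ≢ Member.x (M zero) → adj T (Member.y (M zero)) (Member.π (M zero) ⟨$⟩ʳ z) ≡ (z == u)) where

  private
    open module M₀ = Member (M zero) using () renaming (x to x₀)
    Ψ₀ = Ψ (M zero)
    Ψ₀-iso = Ψ-iso (M zero) Fy u≢x at-y

    dx⁺ : deg (addLeaf U u) (suc x₀) ≡ 2
    dx⁺ = trans (deg-old U (_== u) x₀) (cong₂ _+_ (cong ι (==-false (u≢x ∘ sym))) dx)

  supercard : SunSuper U T
  supercard = record
    { Up = addLeaf U u ; w = zero ; v = suc x₀
    ; sunshine = addLeaf-sunshine U u-skel sunU
    ; cardW = Perm.id , λ i j → refl
    ; cardV = iso⇒card-≅ {G = addLeaf U u} {addVertex T F} Ψ₀ Ψ₀-iso {suc x₀} {zero} (Ψ-x (M zero))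
    ; wLeaf = deg-addLeaf-new U u
    ; vDeg2 = dx⁺
    ; vCycle = ≤-reflexive (sym dx⁺)
    }

  private
    -- Pulling each gluing map back along the isomorphism `Ψ₀` makes it a map of the supercard to
    -- itself, the identity for the first member. It takes `x` of the member to `v`, and `w` to the
    -- vertex corresponding to its `y`, whence the separation.
    Λ : Fin (suc k) → Permutation′ (suc (suc m))
    Λ t = Ψ (M t) ∘ₚ Perm.flip Ψ₀

    Ψ₀Λ : ∀ t z → Ψ₀ ⟨$⟩ʳ (Λ t ⟨$⟩ʳ z) ≡ Ψ (M t) ⟨$⟩ʳ z
    Ψ₀Λ t z = inverseʳ Ψ₀

    off : ∀ t → IsoOff zero (Λ t) (addLeaf U u) (addLeaf U u)
    off t zero    _       a≢ _  = contradiction refl a≢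
    off t (suc a) zero    _  b≢ = contradiction refl b≢
    off t (suc a) (suc b) _  _  = trans (sym (Ψ₀-iso (Λ t ⟨$⟩ʳ suc a) (Λ t ⟨$⟩ʳ suc b)))
      (trans (cong₂ (adj (addVertex T F)) (Ψ₀Λ t (suc a)) (Ψ₀Λ t (suc b))) (Ψ-off (M t) a b))

    bu : ∀ t → BU supercard (Λ t)
    bu t = (λ a b a≢w _ b≢w _ → off t a b a≢w b≢w) , off t

    Λ⁻¹v : ∀ t → Λ t ⟨$⟩ˡ suc x₀ ≡ suc (Member.x (M t))
    Λ⁻¹v t = perm-inj (Ψ (M t)) (trans (inverseʳ (Ψ (M t))) (trans (Ψ-x (M zero)) (sym (Ψ-x (M t)))))

    Ψ₀Λw : ∀ t → Ψ₀ ⟨$⟩ʳ (Λ t ⟨$⟩ʳ zero) ≡ suc (Member.y (M t))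
    Ψ₀Λw t = trans (Ψ₀Λ t zero) (Ψ-zero (M t))

    separated : Separated supercard (suc k) Λ
    separated = record
      { inB = proj₁ ∘ bu
      ; hasId = zero , λ z → inverseˡ Ψ₀
      ; separate = λ i j ne →
          (λ e → ne (x-inj (F.suc-injective (trans (sym (Λ⁻¹v i)) (trans e (Λ⁻¹v j)))))) ,
          (λ e → ne (y-inj (F.suc-injective (trans (sym (Ψ₀Λw i)) (trans (cong (Ψ₀ ⟨$⟩ʳ_) e) (Ψ₀Λw j))))))
      }

  supercard-chi : ¬ ¬ ChiAtLeast supercard (suc k)
  supercard-chi = separated⇒chi supercard separated bu

-- Spines and walks

-- The first step fixes the direction; a later reversal would give `β (2 + r) = β r`. `climb`
-- carries the last step along with the value for this purpose.
monotone : (β : ℕ → ℕ) (L : ℕ) →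
           (∀ r → r < L → suc (β r) ≡ β (suc r) ⊎ suc (β (suc r)) ≡ β r) →
           (∀ r → suc r < L → β (2 + r) ≢ β r) →
           (∀ r → r ≤ L → β r ≡ β 0 + r) ⊎ (∀ r → r ≤ L → β r + r ≡ β 0)
monotone β zero    adjacent noturn = inj₁ λ { .0 z≤n → sym (+-identityʳ (β 0)) }
monotone β (suc L) adjacent noturn with adjacent 0 (s≤s z≤n)
... | inj₁ up = inj₁ λ { zero _ → sym (+-identityʳ (β 0)) ; (suc r) h → proj₂ (climb r h) }
  where
  climb : ∀ r → suc r ≤ suc L → suc (β r) ≡ β (suc r) × β (suc r) ≡ β 0 + suc r
  climb zero    h = up , trans (sym up) (+-comm 1 (β 0))
  climb (suc r) h with climb r (≤-trans (n≤1+n _) h) | adjacent (suc r) h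
  ... | prev , e | inj₁ e′ = e′ , trans (sym e′) (trans (cong suc e) (sym (+-suc (β 0) (suc r))))
  ... | prev , e | inj₂ e′ = contradiction (suc-injective (trans e′ (sym prev))) (noturn r h)
... | inj₂ down = inj₂ λ { zero _ → +-identityʳ (β 0) ; (suc r) h → proj₂ (climb r h) }
  where
  climb : ∀ r → suc r ≤ suc L → suc (β (suc r)) ≡ β r × β (suc r) + suc r ≡ β 0
  climb zero    h = down , trans (+-comm _ 1) down
  climb (suc r) h with climb r (≤-trans (n≤1+n _) h) | adjacent (suc r) h
  ... | prev , e | inj₂ e′ = e′ , trans (+-suc _ (suc r)) (trans (cong (_+ suc r) e′) e)
  ... | prev , e | inj₁ e′ = contradiction (trans (sym e′) prev) (noturn r h)

record Spine (T : Graph n) (k′ : ℕ) : Set where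
  field
    q          : Fin (suc k′) → Fin n
    q-inj      : Injective _≡_ _≡_ q
    q-skel     : ∀ i → InSkel T (q i)
    q-onto     : ∀ {x} → InSkel T x → ∃ λ i → q i ≡ x
    q-step     : ∀ i j → suc (toℕ i) ≡ toℕ j → q i ∼[ T ] q j
    q-adjacent : ∀ i j → q i ∼[ T ] q j → suc (toℕ i) ≡ toℕ j ⊎ suc (toℕ j) ≡ toℕ i
    ℓ₀ ℓ₁      : Fin n
    ℓ₀-leaf    : ¬ InSkel T ℓ₀
    ℓ₁-leaf    : ¬ InSkel T ℓ₁
    ℓ₀-adj     : q zero ∼[ T ] ℓ₀
    ℓ₁-adj     : q (fromℕ k′) ∼[ T ] ℓ₁

opposite-sum : ∀ {k′} (i : Fin (suc k′)) → toℕ (opposite i) + toℕ i ≡ k′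
opposite-sum {k′} i = suc-injective (trans (sym (+-suc _ (toℕ i))) (trans (cong (_+ suc (toℕ i)) (F.opposite-prop i)) (m∸n+n≡m (F.toℕ<n i))))

opposite-inj : ∀ {k} {i j : Fin k} → opposite i ≡ opposite j → i ≡ j
opposite-inj {i = i} {j} e = trans (sym (F.opposite-involutive i)) (trans (cong opposite e) (F.opposite-involutive j))

opposite-step : ∀ {k′} (i j : Fin (suc k′)) → suc (toℕ i) ≡ toℕ j → suc (toℕ (opposite j)) ≡ toℕ (opposite i)
opposite-step i j e = +-cancelʳ-≡ (toℕ i) _ _ (trans (sym (+-suc _ (toℕ i)))
  (trans (cong (toℕ (opposite j) +_) e) (trans (opposite-sum j) (sym (opposite-sum i)))))

opposite-last : ∀ k′ → opposite (fromℕ k′) ≡ zero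
opposite-last k′ = F.opposite-involutive {suc k′} zero

spine : ∀ (T : Graph n) → SkeletonIsPath T → ∃ (Spine T)
spine T (suc k′ , q , _ , inj , skel , adjacent) = k′ , record
  { q = q ; q-inj = inj ; q-skel = q-skel
  ; q-onto = λ {x} → Equivalence.to (skel x)
  ; q-step = λ i j e → Equivalence.from (adjacent i j) (inj₁ e)
  ; q-adjacent = λ i j → Equivalence.to (adjacent i j)
  ; ℓ₀ = proj₁ low ; ℓ₁ = proj₁ high
  ; ℓ₀-leaf = proj₂ (proj₂ low) ; ℓ₁-leaf = proj₂ (proj₂ high)
  ; ℓ₀-adj = proj₁ (proj₂ low) ; ℓ₁-adj = proj₁ (proj₂ high)
  }
  where
  q-skel : ∀ i → InSkel T (q i)
  q-skel i = Equivalence.from (skel (q i)) (i , refl)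
  -- A vertex with at most one spine neighbour has degree at least 2, so of two of its neighbours
  -- one is off the spine.
  leaf-at : ∀ i → (∀ j j′ → q i ∼[ T ] q j → q i ∼[ T ] q j′ → toℕ j ≡ toℕ j′) → ∃ λ l → q i ∼[ T ] l × ¬ InSkel T l
  leaf-at i unique with other-neighbour T (q-skel i) (q i)
  ... | b , e , _ with skel? T b
  ...   | no h = b , e , h
  ...   | yes h with other-neighbour T (q-skel i) b
  ...     | b′ , e′ , ne = b′ , e′ , λ h′ → case h h′
    where
    case : InSkel T b → InSkel T b′ → ⊥
    case h h′ with Equivalence.to (skel b) h | Equivalence.to (skel b′) h′
    ... | j , refl | j′ , refl = ne (cong q (F.toℕ-injective (unique j′ j e′ e)))
  low : ∃ λ l → q zero ∼[ T ] l × ¬ InSkel T l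
  low = leaf-at zero λ j j′ e e′ → trans (sym (one j e)) (one j′ e′)
    where
    one : ∀ j → q zero ∼[ T ] q j → 1 ≡ toℕ j
    one j e with Equivalence.to (adjacent zero j) e
    ... | inj₁ p = p
  high : ∃ λ l → q (fromℕ k′) ∼[ T ] l × ¬ InSkel T l
  high = leaf-at (fromℕ k′) λ j j′ e e′ → suc-injective (trans (one j e) (sym (one j′ e′)))
    where
    one : ∀ j → q (fromℕ k′) ∼[ T ] q j → suc (toℕ j) ≡ k′
    one j e with Equivalence.to (adjacent (fromℕ k′) j) e
    ... | inj₁ p = contradiction (trans (cong suc (sym (F.toℕ-fromℕ k′))) p) (<⇒≢ (F.toℕ<n j) ∘ sym)
    ... | inj₂ p = trans p (F.toℕ-fromℕ k′)

reverse-spine : ∀ {T : Graph n} {k′} → Spine T k′ → Spine T k′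
reverse-spine {T = T} {k′} S = record
  { q = q ∘ opposite ; q-inj = opposite-inj ∘ q-inj ; q-skel = q-skel ∘ opposite
  ; q-onto = λ h → let i , e = q-onto h in opposite i , trans (cong q (F.opposite-involutive i)) e
  ; q-step = λ i j e → ∼-sym T (q-step (opposite j) (opposite i) (opposite-step i j e))
  ; q-adjacent = λ i j e → [ inj₂ ∘ back j i , inj₁ ∘ back i j ]′ (q-adjacent (opposite i) (opposite j) e)
  ; ℓ₀ = ℓ₁ ; ℓ₁ = ℓ₀ ; ℓ₀-leaf = ℓ₁-leaf ; ℓ₁-leaf = ℓ₀-leaf
  ; ℓ₀-adj = ℓ₁-adj
  ; ℓ₁-adj = subst (λ i → q i ∼[ T ] ℓ₀) (sym (opposite-last k′)) ℓ₀-adj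
  }
  where
  open Spine S
  back : ∀ i j → suc (toℕ (opposite j)) ≡ toℕ (opposite i) → suc (toℕ i) ≡ toℕ j
  back i j e = subst₂ (λ a b → suc (toℕ a) ≡ toℕ b) (F.opposite-involutive i) (F.opposite-involutive j)
    (opposite-step (opposite j) (opposite i) e)

module SpineIndex {T : Graph n} {k′ : ℕ} (S : Spine T k′) where
  open Spine S

  index : Fin n → ℕ
  index z with skel? T z
  ... | yes h = toℕ (proj₁ (q-onto h))
  -- A dummy value: the facts about `index` concern skeleton vertices.
  ... | no _  = 0

  index-q : ∀ i → index (q i) ≡ toℕ i
  index-q i with skel? T (q i)
  ... | yes h = cong toℕ (q-inj (proj₂ (q-onto h)))
  ... | no ne = contradiction (q-skel i) ne

  index≤ : ∀ {z} → InSkel T z → index z ≤ k′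
  index≤ h with q-onto h
  ... | i , refl = subst (_≤ k′) (sym (index-q i)) (F.toℕ≤pred[n] i)

  index-inj : ∀ {z z′} → InSkel T z → InSkel T z′ → index z ≡ index z′ → z ≡ z′
  index-inj h h′ e with q-onto h | q-onto h′
  ... | i , refl | j , refl = cong q (F.toℕ-injective (trans (sym (index-q i)) (trans e (index-q j))))

  index-adjacent : ∀ {z z′} → InSkel T z → InSkel T z′ → z ∼[ T ] z′ →
                   suc (index z) ≡ index z′ ⊎ suc (index z′) ≡ index z
  index-adjacent h h′ e with q-onto h | q-onto h′
  ... | i , refl | j , refl rewrite index-q i | index-q j = q-adjacent i j e

  at-zero : ∀ {z} → InSkel T z → index z ≡ 0 → z ≡ q zero
  at-zero h e = index-inj h (q-skel zero) (trans e (sym (index-q zero)))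

  at-last : ∀ {z} → InSkel T z → index z ≡ k′ → z ≡ q (fromℕ k′)
  at-last h e = index-inj h (q-skel _) (trans e (sym (trans (index-q _) (F.toℕ-fromℕ k′))))

  lower-neighbour : ∀ j → (toℕ j ≡ 0 × q j ∼[ T ] ℓ₀) ⊎ (∃ λ i → suc (toℕ i) ≡ toℕ j × q j ∼[ T ] q i)
  lower-neighbour zero    = inj₁ (refl , ℓ₀-adj)
  lower-neighbour (suc j) = inj₂ (inject₁ j , e , ∼-sym T (q-step (inject₁ j) (suc j) e))
    where e = cong suc (F.toℕ-inject₁ j)

  upper-neighbour : ∀ j → (toℕ j ≡ k′ × q j ∼[ T ] ℓ₁) ⊎ (∃ λ i → suc (toℕ j) ≡ toℕ i × q j ∼[ T ] q i)
  upper-neighbour j with toℕ j ≟ k′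
  ... | yes e = inj₁ (e , subst (λ i → q i ∼[ T ] ℓ₁) (F.toℕ-injective (trans (F.toℕ-fromℕ k′) (sym e))) ℓ₁-adj)
  ... | no ne = inj₂ (fromℕ< lt , sym (F.toℕ-fromℕ< lt) , q-step j _ (sym (F.toℕ-fromℕ< lt)))
    where
    lt : suc (toℕ j) < suc k′
    lt = s≤s (≤∧≢⇒< (F.toℕ≤pred[n] j) ne)

index-reverse : ∀ {T : Graph n} {k′} (S : Spine T k′) {z} → InSkel T z →
                SpineIndex.index (reverse-spine S) z + SpineIndex.index S z ≡ k′
index-reverse {k′ = k′} S {z} h with Spine.q-onto S h
... | i , refl = trans (cong₂ _+_
    (trans (cong (SpineIndex.index (reverse-spine S)) (cong (Spine.q S) (sym (F.opposite-involutive i)))) (SpineIndex.index-q (reverse-spine S) (opposite i)))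
    (SpineIndex.index-q S i)) (opposite-sum i)

module Around {U : Graph n} {c′ : ℕ} (C : CycleSkeleton U c′) (a : Fin (suc c′)) where
  open Cyclic {c′}
  open CycleSkeleton C

  walk : ℕ → Fin n
  walk r = p (next^ r a)

  walk-step : ∀ r → walk r ∼[ U ] walk (suc r)
  walk-step r = p-next (next^ r a)

  walk-noturn : ∀ r → walk (2 + r) ≢ walk r
  walk-noturn r e = next²≢ 3≤c _ (p-inj e)

  private
    from-zero : ∀ r → next^ r a ≡ next^ (toℕ a) (next^ r zero)
    from-zero r = trans (cong (next^ r) (sym (next^-toℕ a)))
      (trans (sym (next^-+ r (toℕ a) zero)) (trans (cong (λ s → next^ s zero) (+-comm r (toℕ a))) (next^-+ (toℕ a) r zero)))

  walk-inj : ∀ {r s} → r < suc c′ → s < suc c′ → walk r ≡ walk s → r ≡ s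
  walk-inj {r} {s} r<c s<c e = trans (sym (toℕ-next^-zero r r<c)) (trans (cong toℕ
    (next^-injective (toℕ a) (trans (sym (from-zero r)) (trans (p-inj e) (from-zero s))))) (toℕ-next^-zero s s<c))

  walk-onto : ∀ {z} → InSkel U z → ∃ λ r → r < suc c′ × walk r ≡ z
  walk-onto h with p-onto h
  ... | i , refl = toℕ j , F.toℕ<n j , cong p (trans (from-zero (toℕ j)) (trans (cong (next^ (toℕ a)) (next^-toℕ j)) back))
    where
    preimage = rotation-surjective {next^ (toℕ a)} (next^-comm (toℕ a)) i
    j = proj₁ preimage
    back = proj₂ preimage

  walk-closes : walk (suc c′) ≡ walk 0
  walk-closes = cong p (next^-c a)

-- The cycle of U, cut at one vertex, inside a caterpillar

image-adjacent : ∀ (U T : Graph n) {x} (π : Permutation′ n) → IsoOff x π U T →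
                 ∀ {a b} → a ≢ x → b ≢ x → a ∼[ U ] b → (π ⟨$⟩ʳ a) ∼[ T ] (π ⟨$⟩ʳ b)
image-adjacent U T π off a≢x b≢x e = trans (off _ _ a≢x b≢x) e

-- A cycle avoiding x would be carried into the skeleton of T, along which indices move in unit
-- steps without turning back, hence would grow beyond any bound.
hits-cycle : ∀ {U T : Graph n} {c′ k′} (C : CycleSkeleton U c′) (S : Spine T k′) {x}
             (π : Permutation′ n) → IsoOff x π U T → ∃ λ i → CycleSkeleton.p C i ≡ x
hits-cycle {U = U} {T} {c′} {k′} C S {x} π off with F.any? (λ i → CycleSkeleton.p C i F.≟ x)
... | yes h = h
... | no h = ⊥-elim ([ (λ up → <⇒≱ (s≤s (m≤n+m k′ (β 0))) (subst (_≤ k′) (trans (up (suc k′) ≤-refl) (+-suc (β 0) k′)) (index≤ (skel (suc k′))))) ,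
                       (λ down → <⇒≱ (s≤s (m≤n+m k′ (β (suc k′)))) (subst (_≤ k′) (trans (sym (down (suc k′) ≤-refl)) (+-suc (β (suc k′)) k′)) (index≤ (skel 0)))) ]′
  (monotone β (suc k′) (λ r _ → index-adjacent (skel r) (skel (suc r)) (image-adjacent U T π off (off-x r) (off-x (suc r)) (walk-step r)))
                       (λ r _ e → walk-noturn r (perm-inj π (index-inj (skel (2 + r)) (skel r) e)))))
  where
  open Around C zero
  open SpineIndex S
  off-x : ∀ r → walk r ≢ x
  off-x r e = h (_ , e)
  β : ℕ → ℕ
  β r = index (π ⟨$⟩ʳ walk r)
  skel⁺ : ∀ r → InSkel T (π ⟨$⟩ʳ walk (suc r))
  skel⁺ r = two-neighbours T
    (image-adjacent U T π off (off-x (suc r)) (off-x (2 + r)) (walk-step (suc r)))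
    (image-adjacent U T π off (off-x (suc r)) (off-x r) (∼-sym U (walk-step r)))
    (walk-noturn r ∘ perm-inj π)
  skel : ∀ r → InSkel T (π ⟨$⟩ʳ walk r)
  skel (suc r) = skel⁺ r
  -- `skel⁺` needs a predecessor on the walk; position 0 gets one by going once around.
  skel zero    = subst (λ z → InSkel T (π ⟨$⟩ʳ z)) walk-closes (skel⁺ c′)

-- Deleting an interior vertex y of the spine leaves two non-trivial components, while deleting a
-- cycle vertex leaves one: at most one neighbour of y stays non-isolated.
not-interior : ∀ {U T : Graph n} {c′} (C : CycleSkeleton U c′) → Connected T → ∀ a (π : Permutation′ n) →
               IsoOff (CycleSkeleton.p C a) π U T →
               deg U (CycleSkeleton.p C a) ≡ suc (deg T (π ⟨$⟩ʳ CycleSkeleton.p C a)) →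
               ∀ {s t} → (π ⟨$⟩ʳ CycleSkeleton.p C a) ∼[ T ] s → (π ⟨$⟩ʳ CycleSkeleton.p C a) ∼[ T ] t →
               InSkel T s → InSkel T t → s ≢ t → ⊥
not-interior {U = U} {T} {c′} C conn a π off dx {s} {t} ys yt hs ht s≢t = contradiction total (<⇒≱ (+-monoˡ-< 2 (≤-reflexive (sym dx))))
  where
  open CycleSkeleton C
  open Cyclic {c′}
  x = p a
  y = π ⟨$⟩ʳ x
  -- The totals are `deg U x + 2` and `deg T y + 2`, so `f ≤ g` contradicts `dx`. A neighbour of `x`
  -- off the cycle becomes a vertex whose only neighbour is `y`, hence neither `s` nor `t`; only the
  -- two cycle neighbours need the extra units in `g`.
  f g : Fin _ → ℕ
  f z = ι (adj U x z) + (ι (π ⟨$⟩ʳ z == s) + ι (π ⟨$⟩ʳ z == t))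
  g z = ι (adj T y (π ⟨$⟩ʳ z)) + (ι (z == p (next a)) + ι (z == p (prev a)))
  spread : ∀ z → ι (z == s) + ι (z == t) ≤ ι (adj T y z)
  spread = add-point (adj T y) _ t (add-point (adj T y) (λ _ → 0) s (λ _ → z≤n) refl ys) (cong ι (==-false (s≢t ∘ sym))) yt
  isolated : ∀ z → z ≢ x → x ∼[ U ] z → ¬ InSkel U z → deg T (π ⟨$⟩ʳ z) ≤ 1 × y ∼[ T ] (π ⟨$⟩ʳ z)
  isolated z z≢x e h = ≤-trans small (ι≤1 _) , ∼-sym T (ι-positive (≤-trans (connected⇒deg≥1 T conn (λ e → z≢x (perm-inj π e))) small))
    where
    small : deg T (π ⟨$⟩ʳ z) ≤ ι (adj T (π ⟨$⟩ʳ z) y)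
    small = +-cancelʳ-≤ 1 _ _ (begin
      deg T (π ⟨$⟩ʳ z) + 1                 ≡⟨ cong (λ b → deg T (π ⟨$⟩ʳ z) + ι b) (sym (∼-sym U e)) ⟩
      deg T (π ⟨$⟩ʳ z) + ι (adj U z x)     ≡⟨ deg-isoOff U T π off z z≢x ⟩
      deg U z + ι (adj T (π ⟨$⟩ʳ z) y)     ≤⟨ +-monoˡ-≤ _ (¬skel⇒deg≤1 U h) ⟩
      1 + ι (adj T (π ⟨$⟩ʳ z) y)           ≡⟨ +-comm 1 _ ⟩
      ι (adj T (π ⟨$⟩ʳ z) y) + 1           ∎)
      where open ≤-Reasoning
  pointwise : ∀ z → f z ≤ g z
  pointwise z with adj U x z in e
  ... | false = ≤-trans (spread (π ⟨$⟩ʳ z)) (m≤m+n _ _)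
  ... | true with skel? U z
  ...   | yes h = ≤-trans (+-monoʳ-≤ 1 (spread (π ⟨$⟩ʳ z))) (≤-trans (≤-reflexive (+-comm 1 _)) (+-monoʳ-≤ _ (on-cycle h)))
    where
    on-cycle : InSkel U z → 1 ≤ ι (z == p (next a)) + ι (z == p (prev a))
    on-cycle h with p-onto h
    ... | i , refl with p-adjacent a i e
    ...   | inj₁ refl = ≤-trans (≤-reflexive (cong ι (sym (==-refl (p (next a)))))) (m≤m+n _ _)
    ...   | inj₂ refl = ≤-trans (≤-reflexive (cong ι (sym (==-refl (p (prev a)))))) (m≤n+m _ _)
  ...   | no h with isolated z (∼⇒≢ U e ∘ sym) e h
  ...     | small , e′ = begin
    1 + (ι (π ⟨$⟩ʳ z == s) + ι (π ⟨$⟩ʳ z == t)) ≡⟨ cong (1 +_) (cong₂ _+_ (cong ι (==-false (not-skel hs))) (cong ι (==-false (not-skel ht)))) ⟩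
    1                                           ≡⟨ cong ι (sym e′) ⟩
    ι (adj T y (π ⟨$⟩ʳ z))                      ≤⟨ m≤m+n _ _ ⟩
    g z                                         ∎
    where
    open ≤-Reasoning
    not-skel : ∀ {r} → InSkel T r → π ⟨$⟩ʳ z ≢ r
    not-skel h refl = <⇒≱ h small
  sum-π : ∀ r → sum (λ z → ι (π ⟨$⟩ʳ z == r)) ≡ 1
  sum-π r = trans (sym (sum-permute (λ z → ι (z == r)) π)) (sum-== r)
  total : deg U x + 2 ≤ deg T y + 2
  total = begin
    deg U x + 2             ≡⟨ cong₂ _+_ (deg-sum U x) (sym (trans (∑-distrib-+ (λ z → ι (π ⟨$⟩ʳ z == s)) (λ z → ι (π ⟨$⟩ʳ z == t))) (cong₂ _+_ (sum-π s) (sum-π t)))) ⟩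
    sum (λ z → ι (adj U x z)) + sum (λ z → ι (π ⟨$⟩ʳ z == s) + ι (π ⟨$⟩ʳ z == t)) ≡⟨ sym (∑-distrib-+ (λ z → ι (adj U x z)) (λ z → ι (π ⟨$⟩ʳ z == s) + ι (π ⟨$⟩ʳ z == t))) ⟩
    sum f                   ≤⟨ sum-mono pointwise ⟩
    sum g                   ≡⟨ ∑-distrib-+ (λ z → ι (adj T y (π ⟨$⟩ʳ z))) (λ z → ι (z == p (next a)) + ι (z == p (prev a))) ⟩
    sum (λ z → ι (adj T y (π ⟨$⟩ʳ z))) + sum (λ z → ι (z == p (next a)) + ι (z == p (prev a)))
                            ≡⟨ cong₂ _+_ (sym (deg-permute T π y)) (trans (∑-distrib-+ (λ z → ι (z == p (next a))) (λ z → ι (z == p (prev a)))) (cong₂ _+_ (sum-== (p (next a))) (sum-== (p (prev a))))) ⟩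
    deg T y + 2             ∎
    where open ≤-Reasoning

NonEnd : ∀ {T : Graph n} {k′} → Spine T k′ → Fin n → Set
NonEnd {k′ = k′} S y = y ≢ q zero × y ≢ q (fromℕ k′) × y ≢ ℓ₀ × y ≢ ℓ₁
  where open Spine S

-- A spine vertex other than the two ends has spine neighbours on both sides, which `not-interior`
-- forbids.
leaf-image : ∀ {U T : Graph n} {c′ k′} (C : CycleSkeleton U c′) → Connected T → (S : Spine T k′) → ∀ a (π : Permutation′ n) →
             IsoOff (CycleSkeleton.p C a) π U T →
             deg U (CycleSkeleton.p C a) ≡ suc (deg T (π ⟨$⟩ʳ CycleSkeleton.p C a)) →
             NonEnd S (π ⟨$⟩ʳ CycleSkeleton.p C a) → ¬ InSkel T (π ⟨$⟩ʳ CycleSkeleton.p C a)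
leaf-image {T = T} C conn S a π off dx (n₀ , n₁ , _) h with Spine.q-onto S h
... | j , e with SpineIndex.lower-neighbour S j | SpineIndex.upper-neighbour S j
...   | inj₁ (z , _) | _ = n₀ (trans (sym e) (cong (Spine.q S) (F.toℕ-injective z)))
...   | inj₂ _ | inj₁ (z , _) = n₁ (trans (sym e) (cong (Spine.q S) (F.toℕ-injective (trans z (sym (F.toℕ-fromℕ _))))))
...   | inj₂ (i , i<j , ei) | inj₂ (k , j<k , ek) = not-interior C conn a π off dx
  (subst (λ y → y ∼[ T ] Spine.q S i) e ei) (subst (λ y → y ∼[ T ] Spine.q S k) e ek)
  (Spine.q-skel S i) (Spine.q-skel S k)
  λ p → m≢1+n+m (toℕ i) {1} (trans (cong toℕ (Spine.q-inj S p)) (trans (sym j<k) (cong suc (sym i<j))))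

-- A spine vertex missed by the image of the cycle would come from a leaf of U, hence have degree
-- two with y as one of its neighbours; its other two neighbours (along the spine, or ℓ₀, ℓ₁) rule this out.
covers-spine : ∀ {U T : Graph n} {c′ k′} (C : CycleSkeleton U c′) (S : Spine T k′) → 1 ≤ k′ → ∀ {x} (π : Permutation′ n) →
               IsoOff x π U T → NonEnd S (π ⟨$⟩ʳ x) → ¬ InSkel T (π ⟨$⟩ʳ x) →
               ∀ j → ∃ λ z → InSkel U z × z ≢ x × π ⟨$⟩ʳ z ≡ Spine.q S j
covers-spine {U = U} {T} {k′ = k′} C S 1≤k′ {x} π off (_ , _ , y≢ℓ₀ , y≢ℓ₁) hy j with skel? U (π ⟨$⟩ˡ Spine.q S j)
... | yes h = _ , h , z≢x , inverseʳ π
  where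
  z≢x : π ⟨$⟩ˡ Spine.q S j ≢ x
  z≢x e = hy (subst (InSkel T) (trans (sym (inverseʳ π)) (cong (π ⟨$⟩ʳ_) e)) (Spine.q-skel S j))
... | no h = ⊥-elim (impossible (lower-neighbour j) (upper-neighbour j))
  where
  open Spine S
  open SpineIndex S
  z = π ⟨$⟩ˡ q j
  y = π ⟨$⟩ʳ x
  z≢x : z ≢ x
  z≢x e = hy (subst (InSkel T) (trans (sym (inverseʳ π)) (cong (π ⟨$⟩ʳ_) e)) (q-skel j))
  small : deg T (q j) ≤ 1 + ι (adj T (q j) y)
  small = begin
    deg T (q j)                              ≡⟨ cong (deg T) (sym (inverseʳ π)) ⟩
    deg T (π ⟨$⟩ʳ z)                         ≤⟨ m≤m+n _ _ ⟩
    deg T (π ⟨$⟩ʳ z) + ι (adj U z x)         ≡⟨ deg-isoOff U T π off z z≢x ⟩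
    deg U z + ι (adj T (π ⟨$⟩ʳ z) y)         ≤⟨ +-monoˡ-≤ _ (¬skel⇒deg≤1 U h) ⟩
    1 + ι (adj T (π ⟨$⟩ʳ z) y)               ≡⟨ cong (λ r → 1 + ι (adj T r y)) (inverseʳ π) ⟩
    1 + ι (adj T (q j) y)                    ∎
    where open ≤-Reasoning
  q∼y : q j ∼[ T ] y
  q∼y = ι-positive (≤-pred (≤-trans (q-skel j) small))
  third : ∀ {a b} → q j ∼[ T ] a → q j ∼[ T ] b → a ≢ b → y ≢ a → y ≢ b → ⊥
  third ea eb ne na nb = <⇒≱ (three-neighbours T ea eb q∼y ne (na ∘ sym) (nb ∘ sym)) (≤-trans small (s≤s (ι≤1 _)))
  y≢q : ∀ i → y ≢ q i
  y≢q i e = hy (subst (InSkel T) (sym e) (q-skel i))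
  leaf≢q : ∀ {l} i → ¬ InSkel T l → l ≢ q i
  leaf≢q i hl e = hl (subst (InSkel T) (sym e) (q-skel i))
  impossible : (toℕ j ≡ 0 × q j ∼[ T ] ℓ₀) ⊎ (∃ λ i → suc (toℕ i) ≡ toℕ j × q j ∼[ T ] q i) →
               (toℕ j ≡ k′ × q j ∼[ T ] ℓ₁) ⊎ (∃ λ i → suc (toℕ j) ≡ toℕ i × q j ∼[ T ] q i) → ⊥
  impossible (inj₁ (z , _)) (inj₁ (z′ , _)) = <⇒≱ 1≤k′ (≤-reflexive (trans (sym z′) z))
  impossible (inj₁ (_ , e)) (inj₂ (i , _ , e′)) = third e e′ (leaf≢q i ℓ₀-leaf) y≢ℓ₀ (y≢q i)
  impossible (inj₂ (i , _ , e)) (inj₁ (_ , e′)) = third e e′ (leaf≢q i ℓ₁-leaf ∘ sym) (y≢q i) y≢ℓ₁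
  impossible (inj₂ (i , i<j , e)) (inj₂ (k , j<k , e′)) = third e e′
    (λ p → m≢1+n+m (toℕ i) {1} (trans (cong toℕ (q-inj p)) (trans (sym j<k) (cong suc (sym i<j))))) (y≢q i) (y≢q k)

-- A cycle neighbour of x lands either on the spine end e itself or on a leaf at e.
At : Graph n → Bool → Fin n → Fin n → Set
At T true  e z = z ≡ e
At T false e z = ¬ InSkel T z × e ∼[ T ] z

-- The cycle has length `4 + L`. Apart from `x = walk 0` it has the neighbours of `x` at positions 1
-- and `3 + L`, and between them `L + 1` vertices at `2 + r` that keep both cycle neighbours and so
-- land on the spine.
module PathImage {U T : Graph n} {L k′ : ℕ} (1≤L : 1 ≤ L) (C : CycleSkeleton U (3 + L))
                 (a : Fin (4 + L)) (π : Permutation′ n) (off : IsoOff (CycleSkeleton.p C a) π U T)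
                 (y-leaf : ¬ InSkel T (π ⟨$⟩ʳ CycleSkeleton.p C a)) where

  open Around C a

  x y : Fin n
  x = CycleSkeleton.p C a
  y = π ⟨$⟩ʳ x

  Q : ℕ → Fin n
  Q r = π ⟨$⟩ʳ walk r

  off-x : ∀ r → r < 3 + L → walk (suc r) ≢ x
  off-x r h e = contradiction (walk-inj {suc r} {0} (s≤s h) (s≤s z≤n) e) λ ()

  Q-adjacent : ∀ r → r < 2 + L → Q (1 + r) ∼[ T ] Q (2 + r)
  Q-adjacent r h = image-adjacent U T π off (off-x r (≤-trans h (n≤1+n _))) (off-x (suc r) (s≤s h)) (walk-step (suc r))

  Q-inj : ∀ {r s} → r < 4 + L → s < 4 + L → Q r ≡ Q s → r ≡ s
  Q-inj h h′ e = walk-inj h h′ (perm-inj π e)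

  Q-skel : ∀ r → r ≤ L → InSkel T (Q (2 + r))
  Q-skel r h = two-neighbours T (∼-sym T (Q-adjacent r (s≤s (≤-trans h (n≤1+n _))))) (Q-adjacent (suc r) (s≤s (s≤s h)))
    (walk-noturn (1 + r) ∘ sym ∘ perm-inj π)

  module _ (S : Spine T k′) where
    open SpineIndex S

    1≤k′ : 1 ≤ k′
    1≤k′ with index-adjacent (Q-skel 0 z≤n) (Q-skel 1 1≤L) (Q-adjacent 1 (s≤s (s≤s z≤n)))
    ... | inj₁ e = ≤-trans (s≤s z≤n) (≤-trans (≤-reflexive e) (index≤ (Q-skel 1 1≤L)))
    ... | inj₂ e = ≤-trans (s≤s z≤n) (≤-trans (≤-reflexive e) (index≤ (Q-skel 0 z≤n)))

  module Increasing (S : Spine T k′) (nonEnd : NonEnd S y)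
                    (inc : ∀ r → r ≤ L → SpineIndex.index S (Q (2 + r)) ≡ SpineIndex.index S (Q 2) + r) where
    open Spine S
    open SpineIndex S

    lo : ℕ
    lo = index (Q 2)

    data Position (z : Fin n) : Set where
      first  : Q 1 ≡ z → Position z
      middle : ∀ r → r ≤ L → Q (2 + r) ≡ z → Position z
      final  : Q (3 + L) ≡ z → Position z

    position : ∀ j → Position (q j)
    position j with covers-spine C S (1≤k′ S) π off nonEnd y-leaf j
    ... | z , hz , z≢x , e with walk-onto hz
    ...   | zero          , _ , refl = contradiction refl z≢x
    ...   | suc zero      , _ , refl = first e
    ...   | suc (suc r)   , h , refl with r ≟ suc L
    ...     | yes refl = final e
    ...     | no ne    = middle r (≤-pred (≤∧≢⇒< (≤-pred (≤-pred (≤-pred h))) ne)) e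

    -- `Q 1` is next to `Q 2` on the spine, and the place above `Q 2` is taken by `Q 3`, which
    -- exists because `1 ≤ L`. At the other end `final-index` argues in the same way with `pred L`.
    first-index : InSkel T (Q 1) → suc (index (Q 1)) ≡ lo
    first-index h with index-adjacent h (Q-skel 0 z≤n) (Q-adjacent 0 (s≤s z≤n))
    ... | inj₁ e = e
    ... | inj₂ e = contradiction (Q-inj (s≤s (s≤s z≤n)) (s≤s (s≤s (s≤s (s≤s z≤n))))
      (index-inj h (Q-skel 1 1≤L) (trans (sym e) (trans (+-comm 1 lo) (sym (inc 1 1≤L)))))) λ ()

    final-index : InSkel T (Q (3 + L)) → index (Q (3 + L)) ≡ suc (lo + L)
    final-index h with index-adjacent (Q-skel L ≤-refl) h (Q-adjacent (suc L) ≤-refl)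
    ... | inj₁ e = trans (sym e) (cong suc (inc L ≤-refl))
    ... | inj₂ e = contradiction (Q-inj ≤-refl (s≤s (s≤s (s≤s L′≤1+L))) (index-inj h (Q-skel L′ pred[n]≤n) (suc-injective (begin
      suc (index (Q (3 + L)))  ≡⟨ e ⟩
      index (Q (2 + L))        ≡⟨ inc L ≤-refl ⟩
      lo + L                   ≡⟨ cong (lo +_) (sym 1+L′) ⟩
      lo + suc L′              ≡⟨ +-suc lo L′ ⟩
      suc (lo + L′)            ≡⟨ cong suc (sym (inc L′ pred[n]≤n)) ⟩
      suc (index (Q (2 + L′))) ∎)))) (<⇒≢ (s≤s (s≤s (s≤s pred[n]≤n))) ∘ sym)
      where
      open ≡-Reasoning
      L′ = pred L
      1+L′ : suc L′ ≡ L
      1+L′ = suc-pred L {{>-nonZero 1≤L}}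
      L′≤1+L : L′ ≤ 1 + L
      L′≤1+L = ≤-trans pred[n]≤n (n≤1+n L)

    last = fromℕ k′

    index-last : index (q last) ≡ k′
    index-last = trans (index-q last) (F.toℕ-fromℕ k′)

    -- Some cycle vertex must land on `q zero`. If `Q 1` is on the spine, it lies just below `Q 2`
    -- and must be that vertex, so `lo = 1`; otherwise the increasing stretch starts there and
    -- `lo = 0`. `high` is the mirror image.
    low : ∃ λ κ → At T κ (q zero) (Q 1) × lo ≡ ι κ
    low with skel? T (Q 1) | position zero
    ... | yes h | first e      = true , e , sym (trans (cong suc (sym (trans (cong index e) (index-q zero)))) (first-index h))
    ... | yes h | middle r r≤L e = contradiction (trans (first-index h) (m+n≡0⇒m≡0 lo (trans (sym (inc r r≤L)) (trans (cong index e) (index-q zero))))) λ ()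
    ... | yes h | final e      = contradiction (trans (sym (final-index (subst (InSkel T) (sym e) (q-skel zero)))) (trans (cong index e) (index-q zero))) λ ()
    ... | no h  | first e      = contradiction (subst (InSkel T) (sym e) (q-skel zero)) h
    ... | no h  | middle r r≤L e = false , (h , subst (λ z → z ∼[ T ] Q 1) (at-zero (Q-skel 0 z≤n) lo≡0) (∼-sym T (Q-adjacent 0 (s≤s z≤n)))) , lo≡0
      where
      lo≡0 = m+n≡0⇒m≡0 lo (trans (sym (inc r r≤L)) (trans (cong index e) (index-q zero)))
    ... | no h  | final e      = contradiction (trans (sym (final-index (subst (InSkel T) (sym e) (q-skel zero)))) (trans (cong index e) (index-q zero))) λ ()

    first≢last : Q 1 ≢ q last
    first≢last e = <⇒≱ (subst (suc k′ ≤_) (trans (cong suc (sym (trans (cong index e) index-last))) (first-index (subst (InSkel T) (sym e) (q-skel last)))) ≤-refl)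
      (index≤ (Q-skel 0 z≤n))

    high : ∃ λ κ → At T κ (q last) (Q (3 + L)) × lo + L + ι κ ≡ k′
    high with skel? T (Q (3 + L)) | position last
    ... | _     | first e = contradiction e first≢last
    ... | yes h | final e = true , e , trans (+-comm _ 1) (trans (sym (final-index h)) (trans (cong index e) index-last))
    ... | no h  | final e = contradiction (subst (InSkel T) (sym e) (q-skel last)) h
    ... | yes h | middle r r≤L e = contradiction (≤-trans (≤-reflexive (sym (final-index h))) (index≤ h)) (<⇒≱ (s≤s (≤-trans
            (≤-reflexive (trans (sym index-last) (trans (cong index (sym e)) (inc r r≤L)))) (+-monoʳ-≤ lo r≤L))))
    ... | no h  | middle r r≤L e = false ,
            (h , subst (λ z → z ∼[ T ] Q (3 + L)) (at-last (Q-skel L ≤-refl) (trans (inc L ≤-refl) full)) (Q-adjacent (suc L) ≤-refl)) ,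
            trans (+-identityʳ _) full
      where
      full : lo + L ≡ k′
      full = ≤-antisym (≤-trans (≤-reflexive (sym (inc L ≤-refl))) (index≤ (Q-skel L ≤-refl)))
        (≤-trans (≤-reflexive (trans (sym index-last) (trans (cong index (sym e)) (inc r r≤L)))) (+-monoʳ-≤ lo r≤L))

    ends : ∃ λ κ → ∃ λ κ′ → At T κ (q zero) (Q 1) × At T κ′ (q last) (Q (3 + L)) × ι κ + L + ι κ′ ≡ k′
    ends = let κ , atl , e = low ; κ′ , ath , e′ = high in κ , κ′ , atl , ath , subst (λ r → r + L + ι κ′ ≡ k′) e e′

  walk-last : x ∼[ U ] walk (3 + L)
  walk-last = ∼-sym U (subst (λ z → walk (3 + L) ∼[ U ] z) walk-closes (walk-step (3 + L)))

  ends : (S : Spine T k′) (nonEnd : NonEnd S y) →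
         ∃ λ b → ∃ λ b′ → x ∼[ U ] b × x ∼[ U ] b′ × b ≢ b′ × ∃ λ κ → ∃ λ κ′ →
         At T κ (Spine.q S zero) (π ⟨$⟩ʳ b) × At T κ′ (Spine.q S (fromℕ k′)) (π ⟨$⟩ʳ b′) × ι κ + L + ι κ′ ≡ k′
  ends S nonEnd@(n₁ , n₂ , n₃ , n₄)
    with monotone (λ r → SpineIndex.index S (Q (2 + r))) L
           (λ r h → SpineIndex.index-adjacent S (Q-skel r (<⇒≤ h)) (Q-skel (suc r) h) (Q-adjacent (suc r) (s≤s (≤-trans h (n≤1+n _)))))
           (λ r h e → walk-noturn (2 + r) (perm-inj π (SpineIndex.index-inj S (Q-skel (2 + r) h) (Q-skel r (≤-trans (n≤1+n _) (≤-trans (n≤1+n _) h))) e)))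
  ... | inj₁ inc = let κ , κ′ , atl , ath , e = Increasing.ends S nonEnd inc
    in walk 1 , walk (3 + L) , walk-step 0 , walk-last , distinct , κ , κ′ , atl , ath , e
    where
    distinct : walk 1 ≢ walk (3 + L)
    distinct e = contradiction (walk-inj (s≤s (s≤s z≤n)) ≤-refl e) λ ()
  ... | inj₂ dec = let κ , κ′ , atl , ath , e = Increasing.ends S′ nonEnd′ inc
    in walk (3 + L) , walk 1 , walk-last , walk-step 0 , distinct , κ′ , κ ,
       subst (λ i → At T κ′ (Spine.q S i) (Q (3 + L))) (opposite-last k′) ath , atl ,
       trans (swap (ι κ′) L (ι κ)) e
    where
    S′ = reverse-spine S
    nonEnd′ : NonEnd S′ y
    nonEnd′ = n₂ , (λ e → n₁ (trans e (cong (Spine.q S) (opposite-last k′)))) , n₄ , n₃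
    distinct : walk (3 + L) ≢ walk 1
    distinct e = contradiction (walk-inj ≤-refl (s≤s (s≤s z≤n)) e) λ ()
    swap : ∀ i j k → i + j + k ≡ k + j + i
    swap i j k = trans (+-assoc i j k) (trans (+-comm i _) (cong (_+ i) (+-comm j k)))
    inc : ∀ r → r ≤ L → SpineIndex.index S′ (Q (2 + r)) ≡ SpineIndex.index S′ (Q 2) + r
    inc r h = +-cancelʳ-≡ (SpineIndex.index S (Q (2 + r))) _ _ (begin
      SpineIndex.index S′ (Q (2 + r)) + SpineIndex.index S (Q (2 + r)) ≡⟨ index-reverse S (Q-skel r h) ⟩
      k′                                                               ≡⟨ sym (index-reverse S (Q-skel 0 z≤n)) ⟩
      SpineIndex.index S′ (Q 2) + SpineIndex.index S (Q 2)             ≡⟨ cong (SpineIndex.index S′ (Q 2) +_) (trans (sym (dec r h)) (+-comm _ r)) ⟩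
      SpineIndex.index S′ (Q 2) + (r + SpineIndex.index S (Q (2 + r))) ≡⟨ sym (+-assoc (SpineIndex.index S′ (Q 2)) r _) ⟩
      SpineIndex.index S′ (Q 2) + r + SpineIndex.index S (Q (2 + r))   ∎)
      where open ≡-Reasoning

-- Regular common cards

∨-elim : ∀ {a b} → a ∨ b ≡ true → a ≡ true ⊎ b ≡ true
∨-elim {true}  _ = inj₁ refl
∨-elim {false} e = inj₂ e

∨-introˡ : ∀ {a b} → a ≡ true → a ∨ b ≡ true
∨-introˡ refl = refl

∨-introʳ : ∀ {a b} → b ≡ true → a ∨ b ≡ true
∨-introʳ {true}  _ = refl
∨-introʳ {false} e = e

ι-inj : ∀ {a b} → ι a ≡ ι b → a ≡ b
ι-inj {true}  {true}  _ = refl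
ι-inj {false} {false} _ = refl

ι-∨ : ∀ a b → ι (a ∨ b) ≤ ι a + ι b
ι-∨ true  b = s≤s z≤n
ι-∨ false b = ≤-refl

Twins : Graph n → Fin n → Fin n → Set
Twins T a b = ∀ r → adj T a r ≡ adj T b r

transpose-twins : ∀ (T : Graph n) {a b} → Twins T a b → IsIsoBy (transpose a b) T T
transpose-twins T {a} {b} twins z z′ = trans (half z _) (trans (adj-sym T z _) (trans (half z′ z) (adj-sym T z′ z)))
  where
  moved : ∀ z → Dec (z ≡ a) → Dec (z ≡ b) → Twins T (transpose a b ⟨$⟩ʳ z) z
  moved z (yes refl) _        r = trans (cong (λ t → adj T t r) (transpose-left a b)) (sym (twins r))
  moved z (no _) (yes refl)   r = trans (cong (λ t → adj T t r) (transpose-right a b)) (twins r)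
  moved z (no n₁) (no n₂)     r = cong (λ t → adj T t r) (transpose-other n₁ n₂)
  half : ∀ z → Twins T (transpose a b ⟨$⟩ʳ z) z
  half z = moved z (z F.≟ a) (z F.≟ b)

-- Leaves at a common vertex can be swapped by an automorphism of T. This lets every gluing of one
-- type be moved onto the same two chosen vertices.
At-twins : ∀ (T : Graph n) κ {e z z′} → At T κ e z → At T κ e z′ → Twins T z z′
At-twins T true  refl refl r = refl
At-twins T false (h , e) (h′ , e′) r = bool-ext (through h e e′) (through h′ e′ e)
  where
  through : ∀ {z z′ r e} → ¬ InSkel T z → e ∼[ T ] z → e ∼[ T ] z′ → z ∼[ T ] r → z′ ∼[ T ] r
  through {z′ = z′} h e e′ k = subst (λ r → z′ ∼[ T ] r) (leaf-unique T h (∼-sym T e) k) (∼-sym T e′)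

At-disjoint : ∀ (T : Graph n) κ κ′ {e e′ z} → InSkel T e → InSkel T e′ → e ≢ e′ → At T κ e z → At T κ′ e′ z → ⊥
At-disjoint T true  true  he he′ ne p q = ne (trans (sym p) q)
At-disjoint T true  false he he′ ne refl (h , _) = h he
At-disjoint T false true  he he′ ne (h , _) refl = h he′
At-disjoint T false false he he′ ne (h , p) (_ , q) = ne (leaf-unique T h (∼-sym T p) (∼-sym T q))

module Ends {T : Graph n} {k′ : ℕ} (S : Spine T k′) where
  open Spine S

  lowEnd highEnd : Bool → Fin n
  lowEnd  κ = if κ then q zero else ℓ₀
  highEnd κ = if κ then q (fromℕ k′) else ℓ₁

  lowEnd-At : ∀ κ → At T κ (q zero) (lowEnd κ)
  lowEnd-At true  = refl
  lowEnd-At false = ℓ₀-leaf , ℓ₀-adj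

  highEnd-At : ∀ κ → At T κ (q (fromℕ k′)) (highEnd κ)
  highEnd-At true  = refl
  highEnd-At false = ℓ₁-leaf , ℓ₁-adj

  isEnd : Bool → Bool → Fin n → Bool
  isEnd κ κ′ z = (z == lowEnd κ) ∨ (z == highEnd κ′)

  nonEnd≢low : ∀ {y} → NonEnd S y → ∀ κ → y ≢ lowEnd κ
  nonEnd≢low (h , _ , _ , _) true  = h
  nonEnd≢low (_ , _ , h , _) false = h

  nonEnd≢high : ∀ {y} → NonEnd S y → ∀ κ → y ≢ highEnd κ
  nonEnd≢high (_ , h , _ , _) true  = h
  nonEnd≢high (_ , _ , _ , h) false = h

  nonEnd-isEnd : ∀ {y} → NonEnd S y → ∀ κ κ′ → isEnd κ κ′ y ≡ false
  nonEnd-isEnd h κ κ′ = ≢true λ e → [ nonEnd≢low h κ ∘ ==-sound , nonEnd≢high h κ′ ∘ ==-sound ]′ (∨-elim e)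

-- The end types `κ` and `κ′` tell whether the added vertex is joined to the spine end or to a leaf
-- there. Only `κ` is a parameter, because `lengths` determines `κ′` from it.
record Regular {U T : Graph n} {k′ : ℕ} (S : Spine T k′) (L : ℕ) (κ : Bool) (x y : Fin n) : Set where
  open Ends S
  field
    κ′      : Bool
    lengths : ι κ + L + ι κ′ ≡ k′
    π       : Permutation′ n
    πx      : π ⟨$⟩ʳ x ≡ y
    off     : IsoOff x π U T
    at-x    : ∀ z → z ≢ x → isEnd κ κ′ (π ⟨$⟩ʳ z) ≡ adj U x z
    y-end   : isEnd κ κ′ y ≡ false
    dx      : deg U x ≡ 2
    u       : Fin n
    u-skel  : InSkel U u
    u≢x     : u ≢ x
    at-y    : ∀ z → z ≢ x → adj T y (π ⟨$⟩ʳ z) ≡ (z == u)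

module _ {U T : Graph n} (connT : Connected T) {L k′ : ℕ} (1≤L : 1 ≤ L) (C : CycleSkeleton U (3 + L)) (S : Spine T k′) where

  regular : ∀ {x} (π : Permutation′ n) → IsoOff x π U T → deg U x ≡ suc (deg T (π ⟨$⟩ʳ x)) →
            NonEnd S (π ⟨$⟩ʳ x) → ∃ λ κ → Regular {U = U} S L κ x (π ⟨$⟩ʳ x)
  regular π off dxy nonEnd with hits-cycle C S π off
  ... | a , refl with PathImage.ends 1≤L C a π off (leaf-image C connT S a π off dxy nonEnd) S nonEnd
  ...   | b , b′ , x∼b , x∼b′ , b≢b′ , κ , κ′ , low , high , len = κ , record
    { κ′ = κ′ ; lengths = len ; π = π′ ; πx = π′x ; off = off′
    ; at-x = λ z z≢x → bool-ext
        (λ e → [ (λ e → subst (λ z → x ∼[ U ] z) (perm-inj π′ (trans π′b (sym (==-sound e)))) x∼b) ,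
                 (λ e → subst (λ z → x ∼[ U ] z) (perm-inj π′ (trans π′b′ (sym (==-sound e)))) x∼b′) ]′ (∨-elim e))
        (λ e → [ (λ { refl → ∨-introˡ (==-true π′b) }) , (λ { refl → ∨-introʳ {π′ ⟨$⟩ʳ b′ == A} (==-true π′b′) }) ]′
                 (neighbours-of-deg2 U (≤-reflexive dx) x∼b x∼b′ b≢b′ e))
    ; y-end = nonEnd-isEnd nonEnd κ κ′
    ; dx = dx
    ; u = proj₁ covered ; u-skel = proj₁ (proj₂ covered) ; u≢x = proj₁ (proj₂ (proj₂ covered))
    ; at-y = λ z z≢x → bool-ext
        (λ e → ==-true (perm-inj π′ (trans (leaf-unique T y-leaf e y∼h) (sym u↦h))))
        (λ e → subst (λ r → y ∼[ T ] (π′ ⟨$⟩ʳ r)) (sym (==-sound e)) (subst (λ r → y ∼[ T ] r) (sym u↦h) y∼h))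
    }
    where
    open Spine S
    open Ends S
    y = π ⟨$⟩ʳ CycleSkeleton.p C a
    x = CycleSkeleton.p C a
    y-leaf : ¬ InSkel T y
    y-leaf = leaf-image C connT S a π off dxy nonEnd
    dx : deg U x ≡ 2
    dx = ≤-antisym (≤-trans (≤-reflexive dxy) (s≤s (¬skel⇒deg≤1 T y-leaf))) (CycleSkeleton.p-skel C a)
    A = lowEnd κ
    B = highEnd κ′
    -- Twin swaps bring the images of the two cycle neighbours to the standard vertices. They move
    -- neither `y` nor each other's points, as `apart` and `nonEnd` show.
    τ₁ = transpose (π ⟨$⟩ʳ b) A
    τ₂ = transpose (π ⟨$⟩ʳ b′) B
    π′ = (π ∘ₚ τ₁) ∘ₚ τ₂
    1≤k′ : 1 ≤ k′
    1≤k′ = PathImage.1≤k′ 1≤L C a π off y-leaf S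
    ends≢ : q zero ≢ q (fromℕ k′)
    ends≢ e = <⇒≢ 1≤k′ (trans (cong toℕ (q-inj e)) (F.toℕ-fromℕ k′))
    apart : ∀ {z z′} → At T κ (q zero) z → At T κ′ (q (fromℕ k′)) z′ → z ≢ z′
    apart p p′ refl = At-disjoint T κ κ′ (q-skel zero) (q-skel (fromℕ k′)) ends≢ p p′
    π′b : π′ ⟨$⟩ʳ b ≡ A
    π′b = trans (cong (τ₂ ⟨$⟩ʳ_) (transpose-left (π ⟨$⟩ʳ b) A))
      (transpose-other {i = π ⟨$⟩ʳ b′} {B} (apart (lowEnd-At κ) high) (apart (lowEnd-At κ) (highEnd-At κ′)))
    π′b′ : π′ ⟨$⟩ʳ b′ ≡ B
    π′b′ = trans (cong (τ₂ ⟨$⟩ʳ_) (transpose-other {i = π ⟨$⟩ʳ b} {A} (apart low high ∘ sym) (apart (lowEnd-At κ) high ∘ sym)))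
      (transpose-left (π ⟨$⟩ʳ b′) B)
    π′x : π′ ⟨$⟩ʳ x ≡ y
    π′x = trans (cong (τ₂ ⟨$⟩ʳ_) (transpose-other {i = π ⟨$⟩ʳ b} {A} (moved x∼b) (nonEnd≢low nonEnd κ)))
      (transpose-other {i = π ⟨$⟩ʳ b′} {B} (moved x∼b′) (nonEnd≢high nonEnd κ′))
      where
      moved : ∀ {r} → x ∼[ U ] r → y ≢ π ⟨$⟩ʳ r
      moved e p = ∼⇒≢ U e (perm-inj π p)
    off′ : IsoOff x π′ U T
    off′ r s r≢x s≢x = trans (transpose-twins T (At-twins T κ′ high (highEnd-At κ′)) (τ₁ ⟨$⟩ʳ (π ⟨$⟩ʳ r)) (τ₁ ⟨$⟩ʳ (π ⟨$⟩ʳ s)))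
      (trans (transpose-twins T (At-twins T κ low (lowEnd-At κ)) (π ⟨$⟩ʳ r) (π ⟨$⟩ʳ s)) (off r s r≢x s≢x))
    neighbour : ∃ λ h → y ∼[ T ] h
    neighbour = neighbour-exists T (connected⇒deg≥1 T connT {y} {π ⟨$⟩ʳ b} (λ p → ∼⇒≢ U x∼b (perm-inj π p)))
    h = proj₁ neighbour
    y∼h = proj₂ neighbour
    on-spine = q-onto (leaf-neighbour-skel T connT (q-skel zero) y∼h y-leaf)
    -- The spine neighbour `h` of the leaf `y` comes from a cycle vertex `u` of U; there the new
    -- leaf is attached, so the supercard is again a sunshine graph.
    covered = covers-spine C S 1≤k′ π′ off′ (subst (NonEnd S) (sym π′x) nonEnd) (y-leaf ∘ subst (InSkel T) π′x) (proj₁ on-spine)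
    u↦h : π′ ⟨$⟩ʳ proj₁ covered ≡ h
    u↦h = trans (proj₂ (proj₂ (proj₂ covered))) (proj₂ on-spine)

module _ {U T : Graph (suc m)} (sunU : Sunshine U) {L k′ : ℕ} (S : Spine T k′) where
  open Ends S

  -- κ′ is determined by κ and the lengths, so all regular pairs of type κ glue to one supercard.
  regular-chi : ∀ κ {k} (x y : Fin (suc k) → Fin (suc m)) → Injective _≡_ _≡_ x → Injective _≡_ _≡_ y →
                (∀ t → Regular {U = U} S L κ (x t) (y t)) → Σ (SunSuper U T) λ C → ¬ ¬ ChiAtLeast C (suc k)
  regular-chi κ {k} x y x-inj y-inj R = supercard , supercard-chi
    where
    open module R₀ = Regular (R zero)
    κ′-same : ∀ t → Regular.κ′ (R t) ≡ R₀.κ′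
    κ′-same t = ι-inj (+-cancelˡ-≡ (ι κ + L) _ _ (trans (Regular.lengths (R t)) (sym R₀.lengths)))
    member : Fin (suc k) → Member U T (isEnd κ R₀.κ′)
    member t = record { x = x t ; y = y t ; π = Regular.π (R t) ; πx = Regular.πx (R t) ; off = Regular.off (R t)
                      ; at-x = λ z z≢x → trans (cong (λ κ′ → isEnd κ κ′ (Regular.π (R t) ⟨$⟩ʳ z)) (sym (κ′-same t))) (Regular.at-x (R t) z z≢x) }
    open Supercard sunU member x-inj y-inj R₀.y-end R₀.dx R₀.u-skel R₀.u≢x R₀.at-y

-- Counting common cards by type

module Counting {U T : Graph (suc m)} (sunU : Sunshine U) (connT : Connected T)
                {L k′ : ℕ} (1≤L : 1 ≤ L) (C : CycleSkeleton U (3 + L)) (S : Spine T k′)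
                {b : ℕ} (f g : Fin b → Fin (suc m)) (f-inj : Injective _≡_ _≡_ f) (g-inj : Injective _≡_ _≡_ g)
                (isos : ∀ i → card U (f i) ≅ card T (g i))
                (degrees : degreeSum U ≡ 2 + degreeSum T)
                {s : ℕ} (1≤s : 1 ≤ s) (chi-bound : ∀ (C : SunSuper U T) k → ChiAtLeast C k → suc k ≤ s) where

  open Spine S

  private
    e₁ = q zero
    e₂ = q (fromℕ k′)

    atEnd : Fin b → Bool
    atEnd i = (g i == e₁) ∨ ((g i == e₂) ∨ ((g i == ℓ₀) ∨ (g i == ℓ₁)))

    RegularAt : Bool → Fin b → Set
    RegularAt κ i = Regular {U = U} S L κ (f i) (g i)

    classify : ∀ i → atEnd i ≡ true ⊎ ∃ λ κ → RegularAt κ i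
    classify i with atEnd i in eq | card-≅⇒isoOff {G = U} {T} (isos i)
    ... | true  | _ = inj₁ refl
    ... | false | π , πx , off = inj₂ (subst (λ y → ∃ λ κ → Regular {U = U} S L κ (f i) y) πx
        (regular connT 1≤L C S π off deg-x (subst (NonEnd S) (sym πx) nonEnd)))
      where
      unlisted : atEnd i ≢ true
      unlisted e = true≢false e eq
      nonEnd : NonEnd S (g i)
      nonEnd = (λ e → unlisted (∨-introˡ (==-true e))) ,
               (λ e → unlisted (∨-introʳ {g i == e₁} (∨-introˡ (==-true e)))) ,
               (λ e → unlisted (∨-introʳ {g i == e₁} (∨-introʳ {g i == e₂} (∨-introˡ (==-true e))))) ,
               (λ e → unlisted (∨-introʳ {g i == e₁} (∨-introʳ {g i == e₂} (∨-introʳ {g i == ℓ₀} (==-true e)))))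
      deg-x : deg U (f i) ≡ suc (deg T (π ⟨$⟩ʳ f i))
      deg-x = *-cancelˡ-≡ _ _ 2 (+-cancelˡ-≡ (degreeSum T) _ _ (trans (degreeSum-isoOff U T π off)
        (trans (cong (_+ 2 * deg T (π ⟨$⟩ʳ f i)) degrees)
               (solve 2 (λ t d → con 2 :+ t :+ con 2 :* d := t :+ con 2 :* (con 1 :+ d)) refl (degreeSum T) (deg T (π ⟨$⟩ʳ f i))))))
        where open +-*-Solver

    ofType : ∀ κ {i} → atEnd i ≡ true ⊎ (∃ λ κ → RegularAt κ i) → Bool
    ofType κ (inj₁ _)        = false
    ofType κ (inj₂ (κ₁ , _)) = does (κ₁ ≟ᵇ κ)

    isType : Bool → Fin b → Bool
    isType κ i = ofType κ (classify i)

    type-regular : ∀ κ i → isType κ i ≡ true → RegularAt κ i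
    type-regular κ i h with classify i
    ... | inj₂ (κ₁ , R) with κ₁ ≟ᵇ κ
    ...   | yes refl = R

    -- An empty type builds no supercard and is settled by `1≤s`. Otherwise the doubly negated lower
    -- bound on χ suffices, since the goal is decidable.
    type-small : ∀ κ k (e : Fin k → Fin b) → Injective _≡_ _≡_ e → (∀ t → RegularAt κ (e t)) → suc k ≤ s
    type-small κ zero    e e-inj R = 1≤s
    type-small κ (suc k) e e-inj R = decidable-stable (suc (suc k) ≤? s)
      λ h → let C′ , chi = regular-chi sunU S κ (f ∘ e) (g ∘ e) (e-inj ∘ f-inj) (e-inj ∘ g-inj) R
            in chi λ c → h (chi-bound C′ (suc k) c)

    type-count : ∀ κ → suc (sum (ι ∘ isType κ)) ≤ s
    type-count κ = let e , e-inj , h = enumerate (isType κ) in type-small κ _ e e-inj λ t → type-regular κ (e t) (h t)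

    hits : ∀ r → sum (λ i → ι (g i == r)) ≤ 1
    hits r = count≤1 (λ i → g i == r) λ i j e e′ → g-inj (trans (==-sound e) (sym (==-sound e′)))

    end-count : sum (ι ∘ atEnd) ≤ 4
    end-count = ≤-trans (sum-mono λ i → ≤-trans (ι-∨ (g i == e₁) _) (+-monoʳ-≤ _ (≤-trans (ι-∨ (g i == e₂) _) (+-monoʳ-≤ _ (ι-∨ (g i == ℓ₀) _)))))
      (≤-trans (≤-reflexive (trans (∑-distrib-+ (λ i → ι (g i == e₁)) (λ i → ι (g i == e₂) + (ι (g i == ℓ₀) + ι (g i == ℓ₁))))
                 (cong (sum (λ i → ι (g i == e₁)) +_) (trans (∑-distrib-+ (λ i → ι (g i == e₂)) (λ i → ι (g i == ℓ₀) + ι (g i == ℓ₁)))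
                 (cong (sum (λ i → ι (g i == e₂)) +_) (∑-distrib-+ (λ i → ι (g i == ℓ₀)) (λ i → ι (g i == ℓ₁))))))))
        (+-mono-≤ (hits e₁) (+-mono-≤ (hits e₂) (+-mono-≤ (hits ℓ₀) (hits ℓ₁)))))

    partition : ∀ i → 1 ≤ ι (atEnd i) + (ι (isType true i) + ι (isType false i))
    partition i with classify i
    ... | inj₁ e = ≤-trans (≤-reflexive (sym (cong ι e))) (m≤m+n _ _)
    ... | inj₂ (true  , _) = ≤-trans (m≤m+n 1 _) (m≤n+m _ (ι (atEnd i)))
    ... | inj₂ (false , _) = m≤n+m _ (ι (atEnd i))

  total : b ≤ 2 * s + 3
  total = begin
    b                       ≡⟨ trans (sym (*-identityʳ b)) (sym (sum-const b 1)) ⟩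
    sum {b} (λ _ → 1)       ≤⟨ sum-mono partition ⟩
    sum (λ i → ι (atEnd i) + (ι (isType true i) + ι (isType false i)))
                            ≡⟨ trans (∑-distrib-+ (ι ∘ atEnd) (λ i → ι (isType true i) + ι (isType false i)))
                                     (cong (sum (ι ∘ atEnd) +_) (∑-distrib-+ (ι ∘ isType true) (ι ∘ isType false))) ⟩
    sum (ι ∘ atEnd) + (t₁ + t₂) ≤⟨ +-monoˡ-≤ (t₁ + t₂) end-count ⟩
    -- Four end cards and at most `s - 1` of either type sum to `2 * s + 2`, one below the claim.
    4 + (t₁ + t₂)           ≡⟨ solve 2 (λ a b → con 4 :+ (a :+ b) := (con 1 :+ a) :+ (con 1 :+ b) :+ con 2) refl t₁ t₂ ⟩
    suc t₁ + suc t₂ + 2     ≤⟨ +-monoˡ-≤ 2 (+-mono-≤ (type-count true) (type-count false)) ⟩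
    s + s + 2               ≤⟨ +-monoʳ-≤ (s + s) (n≤1+n 2) ⟩
    s + s + 3               ≡⟨ solve 1 (λ s → s :+ s :+ con 3 := con 2 :* s :+ con 3) refl s ⟩
    2 * s + 3               ∎
    where
    open ≤-Reasoning
    open +-*-Solver
    t₁ = sum (ι ∘ isType true)
    t₂ = sum (ι ∘ isType false)

-- The square-root bound and the assembly

square-cancel-< : ∀ {a b} → a * a < b * b → a < b
square-cancel-< {a} {b} h with suc a ≤? b
... | yes p = p
... | no np = contradiction (*-mono-≤ (≤-pred (≰⇒> np)) (≤-pred (≰⇒> np))) (<⇒≱ h)

theorem4p22 : ∀ (m : ℕ) → 12 ≤ suc m →
    (U T : Graph (suc m)) → Sunshine U → Caterpillar T →
    (b : ℕ) → IsB U T b → 5 ≤ b →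
    (C : SunSuper U T) → ChiMaximal C →
    ¬ (∀ (λ′ : Permutation′ (suc (suc m))) → BU C λ′ ⇔ Aut C λ′) →
    ∀ s → IsFloorSqrt (2 * suc m + 1) s → b ≤ 2 * s + 3
theorem4p22 m 12≤n U T sunU (connT , pathT) b ((f , g , f-inj , g-inj , isos) , _) _ C χ-max BU≠Aut s (_ , n<) =
  -- Were the bound false, no defect could exist, because `bound` would turn it into the inequality;
  -- every element of B_U would then be an automorphism.
  decidable-stable (b ≤? 2 * s + 3) λ b≰ → BU≠Aut λ π → mk⇔
    (λ { (_ , off) x y → decidable-stable (_ ≟ᵇ _) λ ne → b≰ (bound π off λ iso → ne (iso x y)) })
    (λ iso → (λ x y _ _ _ _ → iso x y) , λ x y _ _ → iso x y)
  where
  S = proj₂ (spine T pathT)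
  sunUp = sunshine C

  -- From `12 ≤ n` comes `25 ≤ 2n + 1 < (s + 1)²`.
  5≤s : 5 ≤ s
  5≤s = ≤-pred (square-cancel-< (≤-trans (s≤s (+-monoˡ-≤ 1 (*-monoʳ-≤ 2 12≤n))) n<))

  -- U loses one edge of the supercard and T loses two.
  degrees : degreeSum U ≡ 2 + degreeSum T
  degrees = +-cancelˡ-≡ 2 _ _ (begin
    2 + degreeSum U                           ≡⟨ cong (2 +_) (sym (degreeSum-≅ {G = card (Up C) (w C)} {U} (cardW C))) ⟩
    2 + degreeSum (card (Up C) (w C))         ≡⟨ cong (λ d → 2 * d + degreeSum (card (Up C) (w C))) (sym (wLeaf C)) ⟩
    2 * deg (Up C) (w C) + degreeSum (card (Up C) (w C)) ≡⟨ sym (degreeSum-card (Up C) (w C)) ⟩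
    degreeSum (Up C)                          ≡⟨ degreeSum-card (Up C) (v C) ⟩
    2 * deg (Up C) (v C) + degreeSum (card (Up C) (v C)) ≡⟨ cong (λ d → 2 * d + degreeSum (card (Up C) (v C))) (vDeg2 C) ⟩
    4 + degreeSum (card (Up C) (v C))         ≡⟨ cong (4 +_) (degreeSum-≅ {G = card (Up C) (v C)} {T} (cardV C)) ⟩
    4 + degreeSum T                           ∎)
    where open ≡-Reasoning

  bound : ∀ π → IsoOff (w C) π (Up C) (Up C) → ¬ IsIsoBy π (Up C) (Up C) → b ≤ 2 * s + 3
  bound π⋆ off⋆ ¬iso = by-length _ (proj₂ (cycleSkeleton U (proj₂ sunU)))
    where
    chi-bound : ∀ (C′ : SunSuper U T) k → ChiAtLeast C′ k → suc k ≤ s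
    chi-bound C′ k chi with χ-max C′ k chi
    ... | X , e , e-inj , bu with SunshineGraph.Core.bound (Up C) (proj₁ sunUp) (proj₂ (cycleSkeleton (Up C) (proj₂ sunUp)))
            (w C) (v C) (wLeaf C) (vDeg2 C) π⋆ off⋆ ¬iso (Λ ∘ e) (proj₂ ∘ bu)
            (distinct (λ i → Λ i ⟨$⟩ˡ v C) λ i j → proj₁ ∘ separate i j) (distinct (λ i → Λ i ⟨$⟩ʳ w C) λ i j → proj₂ ∘ separate i j)
      where
      open MaxSaturating X
      distinct : (h : Fin size → Fin (2 + m)) → (∀ i j → i ≢ j → h i ≢ h j) → Injective _≡_ _≡_ (h ∘ e)
      distinct h ne {i} {j} p with i F.≟ j
      ... | yes q  = q
      ... | no i≢j = contradiction p (ne (e i) (e j) (i≢j ∘ e-inj))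
    ...   | inj₁ k≤4 = ≤-trans (s≤s k≤4) 5≤s
    -- Here `h` refers to the `n + 1` vertices of U⁺; after cancelling 1 it reads
    -- `(k + 1)² ≤ 2n + 1 < (s + 1)²`.
    ...   | inj₂ h   = ≤-pred (square-cancel-< (≤-trans (s≤s (+-cancelʳ-≤ 1 _ _ (≤-trans h (≤-reflexive 2N)))) n<))
      where
      2N : 2 * (2 + m) ≡ 2 * suc m + 1 + 1
      2N = solve 1 (λ m → con 2 :* (con 2 :+ m) := con 2 :* (con 1 :+ m) :+ con 1 :+ con 1) refl m
        where open +-*-Solver

    by-length : ∀ c′ → CycleSkeleton U c′ → b ≤ 2 * s + 3
    by-length c′ C₁ with 4 ≤? c′
    ... | yes 4≤c′ with m≤n⇒∃[o]m+o≡n 4≤c′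
    ...   | L′ , refl = Counting.total sunU connT {suc L′} (s≤s z≤n) C₁ S f g f-inj g-inj isos degrees (≤-trans (s≤s z≤n) 5≤s) chi-bound
    -- For a cycle of length at most 4, where `PathImage` has no room, the deleted vertices of U are
    -- distinct cycle vertices, so `b ≤ 4`.
    by-length c′ C₁ | no c′≱4 = begin
      b          ≤⟨ F.injective⇒≤ {f = position} position-inj ⟩
      suc c′     ≤⟨ ≰⇒> c′≱4 ⟩
      4          ≤⟨ n≤1+n 4 ⟩
      5          ≤⟨ 5≤s ⟩
      s          ≤⟨ m≤m+n s _ ⟩
      2 * s      ≤⟨ m≤m+n _ 3 ⟩
      2 * s + 3  ∎
      where
      open ≤-Reasoning
      hit : ∀ i → ∃ λ r → CycleSkeleton.p C₁ r ≡ f i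
      hit i = let π , _ , off = card-≅⇒isoOff {G = U} {T} (isos i) in hits-cycle C₁ S π off
      position : Fin b → Fin (suc c′)
      position i = proj₁ (hit i)
      position-inj : Injective _≡_ _≡_ position
      position-inj {i} {j} e = f-inj (trans (sym (proj₂ (hit i))) (trans (cong (CycleSkeleton.p C₁) e) (proj₂ (hit j))))
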